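{- Let $G=(V,E)$ be a finite, strongly connected directed multigraph (loops and multiple edges allowed), with $n=\#V$. The following are equivalent. \begin{enumerate} \item $\mathrm{Im}(\Delta:\mathbb{Z}^V\to\mathbb{Z}^V)=\mathbb{Z}^V_0$. \item $M_G=1$. \item A chip configuration $\sigma\in\mathbb{Z}^V$ on $G$ stabilizes if and only if $|\sigma|\le \#E-\#V$. \item For all $s\in V$, the sandpile group $K(G,s)$ is cyclic with generator $\overline{\beta_s}$. \item For some $s\in V$, the sandpile group $K(G,s)$ is cyclic with generator $\overline{\beta_s}$. \end{enumerate}
   Context: For $v,w\in V$, $d_{vw}$ is the number of directed edges from $v$ to $w$, and $d_v$ is the outdegree of $v$. The graph Laplacian $\Delta:\mathbb{Z}^V\to\mathbb{Z}^V$ is $\Delta f(v)=d_v f(v)-\sum_{e:\,\mathrm{head}(e)=v} f(\mathrm{tail}(e))$; as a matrix, $\Delta_{vw}=-d_{wv}$ for $v\ne w$ and $\Delta_{vv}=d_v-d_{vv}$. $\mathbb{Z}^V_0=\{\sigma\in\mathbb{Z}^V:\sum_v\sigma(v)=0\}$, and $|\sigma|=\sum_{v\in V}\sigma(v)$. For $v\in V$, $\kappa(v)$ is the number of oriented spanning trees rooted at $v$ (spanning subgraphs in which every vertex other than $v$ has outdegree $1$, $v$ has outdegree $0$, and there are no directed cycles). The Pham index is $M_G=\gcd\{\kappa(v):v\in V\}$. A chip configuration is any $\sigma\in\mathbb{Z}^V$. Vertex $v$ is active for $\sigma$ if $\sigma(v)\ge d_v$; firing $v$ replaces $\sigma$ by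 $\sigma-\Delta\delta_v$, where $\delta_v$ is the indicator of $v$. A configuration is stable if $\sigma(v)<d_v$ for all $v$. A legal firing sequence is a sequence $\sigma_0,\dots,\sigma_k$ in which each $\sigma_i$ is obtained from $\sigma_{i-1}$ by firing a vertex active for $\sigma_{i-1}$; $\sigma$ stabilizes if there is a legal firing sequence starting at $\sigma$ and ending at a stable configuration. For a sink $s\in V$, $\Delta_s$ is the matrix obtained from $\Delta$ by deleting the row and column of $s$, and the sandpile group is $K(G,s)=\mathbb{Z}^{V\setminus\{s\}}/\Delta_s\mathbb{Z}^{V\setminus\{s\}}$. $\beta_s\in\mathbb{Z}^{V\setminus\{s\}}$ is $\beta_s(v)=d_{sv}$, and $\overline{\beta_s}$ denotes its class in $K(G,s)$. -}

module Defs where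

open import Data.Nat as ℕ using (ℕ; zero; suc)
open import Data.Nat.GCD using (gcd)
open import Data.Integer as ℤ using (ℤ; +_; _-_; _*_)
open import Data.Fin using (Fin; _≟_; punchIn)
open import Data.Bool using (Bool; true; false; _∧_; not; if_then_else_; T)
open import Data.Maybe using (Maybe; just; nothing)
open import Data.List using (List; []; _∷_; map; foldr; allFin; concatMap; length)
open import Data.Vec as Vec using (Vec; lookup)
open import Data.Product using (Σ; ∃; _×_; _,_)
open import Relation.Nullary.Decidable using (⌊_⌋)
open import Relation.Binary.PropositionalEquality using (_≡_; _≢_)
open import Function.Bundles using (_⇔_)

record Graph (N : ℕ) : Set where
  field
    nE   : ℕ
    tail : Fin nE → Fin N
    head : Fin nE → Fin N

module _ {N : ℕ} (G : Graph N) where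
  open Graph G

  sumℕ : ∀ {k} → (Fin k → ℕ) → ℕ
  sumℕ {k} f = foldr ℕ._+_ 0 (map f (allFin k))

  sumℤ : ∀ {k} → (Fin k → ℤ) → ℤ
  sumℤ {k} f = foldr ℤ._+_ (+ 0) (map f (allFin k))

  [_] : Bool → ℕ
  [ b ] = if b then 1 else 0

  data Path : Fin N → Fin N → Set where
    here : ∀ {v} → Path v v
    step : ∀ {w} (e : Fin nE) → Path (head e) w → Path (tail e) w

  StronglyConnected : Set
  StronglyConnected = ∀ v w → Path v w

  d : Fin N → Fin N → ℕ
  d v w = sumℕ (λ e → [ ⌊ tail e ≟ v ⌋ ∧ ⌊ head e ≟ w ⌋ ])

  outdeg : Fin N → ℕ
  outdeg v = sumℕ (λ e → [ ⌊ tail e ≟ v ⌋ ])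

  Δ : (Fin N → ℤ) → (Fin N → ℤ)
  Δ f v = + outdeg v * f v - sumℤ (λ e → + [ ⌊ head e ≟ v ⌋ ] * f (tail e))

  δ : Fin N → Fin N → ℤ
  δ w v = + [ ⌊ v ≟ w ⌋ ]

  Δmat : Fin N → Fin N → ℤ
  Δmat v w = Δ (δ w) v

  ∣_∣ : (Fin N → ℤ) → ℤ
  ∣ σ ∣ = sumℤ σ

  -- Oriented spanning trees.  A candidate t assigns to each vertex u
  -- either nothing or one edge; it is an oriented spanning tree rooted
  -- at v iff t v = nothing, every u ≠ v gets an edge with tail u
  -- (so every u ≠ v has outdegree 1 and v outdegree 0), and there is no
  -- directed cycle, i.e. following the chosen edges from any vertex
  -- reaches v (after N steps, v being fixed).

  allVecs : ∀ {A : Set} → List A → (k : ℕ) → List (Vec A k)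
  allVecs xs zero    = Vec.[] ∷ []
  allVecs xs (suc k) = concatMap (λ a → map (a Vec.∷_) (allVecs xs k)) xs

  allChoices : List (Maybe (Fin nE))
  allChoices = nothing ∷ map just (allFin nE)

  parent : Vec (Maybe (Fin nE)) N → Fin N → Fin N
  parent t u with lookup t u
  ... | nothing = u
  ... | just e  = head e

  iter : ℕ → (Fin N → Fin N) → Fin N → Fin N
  iter zero    f u = u
  iter (suc k) f u = iter k f (f u)

  validAt : Fin N → Vec (Maybe (Fin nE)) N → Fin N → Bool
  validAt v t u with lookup t u
  ... | nothing = ⌊ u ≟ v ⌋
  ... | just e  = not ⌊ u ≟ v ⌋ ∧ ⌊ tail e ≟ u ⌋

  isTree : Fin N → Vec (Maybe (Fin nE)) N → Bool
  isTree v t = foldr _∧_ true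
    (map (λ u → validAt v t u ∧ ⌊ iter N (parent t) u ≟ v ⌋) (allFin N))

  κ : Fin N → ℕ
  κ v = foldr ℕ._+_ 0
          (map (λ t → [ isTree v t ]) (allVecs allChoices N))

  M : ℕ
  M = foldr gcd 0 (map κ (allFin N))

  Config : Set
  Config = Fin N → ℤ

  Active : Config → Fin N → Set
  Active σ v = + outdeg v ℤ.≤ σ v

  Stable : Config → Set
  Stable σ = ∀ v → σ v ℤ.< + outdeg v

  fire : Fin N → Config → Config
  fire v σ u = σ u - Δ (δ v) u

  data LegalSeq : Config → Config → Set where
    done : ∀ {σ} → LegalSeq σ σ
    fireStep : ∀ {σ τ} (v : Fin N) → Active σ v → LegalSeq (fire v σ) τ → LegalSeq σ τ

  Stabilizes : Config → Set
  Stabilizes σ = ∃ λ τ → LegalSeq σ τ × Stable τ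

  -- Sandpile group K(G,s) = ℤ^{V∖s} / Δ_s ℤ^{V∖s}, with V∖s ≅ Fin n
  -- via punchIn s (N = suc n).

module _ {n : ℕ} (G : Graph (suc n)) where
  open Graph G

  Δred : Fin (suc n) → (Fin n → ℤ) → (Fin n → ℤ)
  Δred s y i = sumℤ G (λ j → Δmat G (punchIn s i) (punchIn s j) * y j)

  β : Fin (suc n) → Fin n → ℤ
  β s i = + d G s (punchIn s i)

  -- K(G,s) is cyclic with generator the class of β_s:
  -- every class is an integer multiple of [β_s].
  CyclicGenByβ : Fin (suc n) → Set
  CyclicGenByβ s = ∀ (x : Fin n → ℤ) →
    ∃ λ (k : ℤ) → ∃ λ (y : Fin n → ℤ) → ∀ i → x i - k * β s i ≡ Δred s y i

  Cond1 : Set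
  Cond1 = ∀ (σ : Fin (suc n) → ℤ) → (∣_∣ G σ ≡ + 0) ⇔ (∃ λ f → ∀ v → Δ G f v ≡ σ v)

  Cond2 : Set
  Cond2 = M G ≡ 1

  Cond3 : Set
  Cond3 = ∀ (σ : Fin (suc n) → ℤ) → Stabilizes G σ ⇔ (∣_∣ G σ ℤ.≤ + nE - + suc n)

  Cond4 : Set
  Cond4 = ∀ s → CyclicGenByβ s

  Cond5 : Set
  Cond5 = ∃ λ s → CyclicGenByβ s

{-# OPTIONS --safe #-}

-- Expanding the determinant of Δ multilinearly in its columns, with column w
-- replaced by a basis vector, gives one term per candidate tree; the term is 1
-- for an oriented spanning tree rooted at w and 0 otherwise, so this
-- determinant is κ(w). By Cramer's rule κ(w)·ℤ₀ ⊆ Im Δ for every w, hence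
-- M·ℤ₀ ⊆ Im Δ, and Δκ = 0. Conversely, if Im Δ = ℤ₀, the vectors e_v − e_0 are
-- combinations of columns of Δ; as an alternating form of n such vectors
-- reduces modulo M to its values on n columns, which are ±κ(w), it follows that
-- M divides det(e_0, e_1 − e_0, …, e_n − e_0) = 1.
--
-- The maximal stable configuration d − 1 has #E − #V chips. If all
-- configurations of that size stabilize, then for |σ| = 0 the stabilization of
-- σ + (d − 1) can only be d − 1, and the firing vector f satisfies Δf = σ. If
-- Im Δ = ℤ₀, some f takes σ to a stable σ − Δf; adding a multiple of the kernel
-- vector κ, which is positive by strong connectedness, makes f ≥ 0, and then
-- legal firing terminates because no vertex v fires more than f(v) times.
--
-- Deleting the coordinate s identifies ℤ₀ with ℤ^{V∖s} and the column of Δ at s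
-- with −β_s, so Im Δ = ℤ₀ says that β_s generates K(G,s).
module Submission where

open import Defs
open import Data.Nat as ℕ using (ℕ; zero; suc)
import Data.Nat.Properties as ℕₚ
import Data.Nat.Divisibility as ℕ∣
open import Data.Nat.GCD using (gcd; gcd-GCD; gcd[m,n]∣m; gcd[m,n]∣n; module Bézout)
open import Data.Integer as ℤ using (ℤ; _+_; _*_; _-_; -_; 0ℤ; 1ℤ; -1ℤ)
import Data.Integer.Properties as ℤₚ
open import Data.Integer.Divisibility.Signed using (_∣_; divides; ∣m∣n⇒∣m+n; ∣n⇒∣m*n; ∣m⇒∣-m; ∣ᵤ⇒∣; ∣⇒∣ᵤ)
open import Data.Integer.Tactic.RingSolver using (solve-∀)
open import Data.Fin as Fin using (Fin; zero; suc; _≟_; punchIn)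
import Data.Fin.Properties as Finₚ
open import Data.Bool using (Bool; true; false; if_then_else_; not; _∧_)
import Data.Bool.Properties as Boolₚ
open import Data.Maybe as Maybe using (Maybe; just; nothing; maybe)
open import Data.Sum using (_⊎_; inj₁; inj₂)
open import Data.Empty using (⊥-elim)
open import Data.Product using (∃; _×_; _,_; proj₁; proj₂)
open import Data.List using (List; []; _∷_; map; foldr; allFin; tabulate; length; _++_; concatMap)
import Data.List.Properties as Listₚ
open import Data.List.Membership.Propositional using (_∈_)
open import Data.List.Membership.Propositional.Properties using (∈-∃++; ∈-allFin; ∈-++⁺ʳ; ∈-map⁺)
open import Data.List.Relation.Unary.Any using (here; there)
open import Data.List.Relation.Unary.All as All using (All; []; _∷_)
import Data.List.Relation.Unary.All.Properties as Allₚ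
open import Data.List.Relation.Unary.AllPairs using ([]; _∷_)
open import Data.List.Relation.Unary.Unique.Propositional using (Unique)
open import Data.List.Relation.Unary.Unique.Propositional.Properties using (allFin⁺)
open import Data.List.Relation.Binary.Sublist.Propositional using (_⊆_; []; _∷_; _∷ʳ_)
import Data.List.Relation.Binary.Sublist.Propositional.Properties as Subₚ
open import Data.Vec as Vec using (Vec; []; _∷_; lookup)
import Data.Vec.Properties as Vecₚ
open import Data.Vec.Functional using (insertAt)
open import Data.Vec.Functional.Properties using (insertAt-lookup; insertAt-punchIn)
open import Relation.Nullary using (yes; no)
open import Relation.Nullary.Decidable using (⌊_⌋)
open import Relation.Binary.PropositionalEquality
open import Function using (_∘_; id)
open import Function.Bundles using (_⇔_; mk⇔; Equivalence)

-- Finite sums over lists and over `Fin k`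

∑ : {I : Set} → List I → (I → ℤ) → ℤ
∑ us f = foldr _+_ 0ℤ (map f us)

ind : Bool → ℤ
ind b = ℤ.+ (if b then 1 else 0)

module _ {I : Set} where

  ∑-cong : {f g : I → ℤ} (us : List I) → (∀ u → f u ≡ g u) → ∑ us f ≡ ∑ us g
  ∑-cong []       eq = refl
  ∑-cong (u ∷ us) eq = cong₂ _+_ (eq u) (∑-cong us eq)

  ∑-0 : {f : I → ℤ} (us : List I) → (∀ u → f u ≡ 0ℤ) → ∑ us f ≡ 0ℤ
  ∑-0 []       eq = refl
  ∑-0 (u ∷ us) eq = cong₂ _+_ (eq u) (∑-0 us eq)

  ∑-+ : (f g : I → ℤ) (us : List I) → ∑ us (λ u → f u + g u) ≡ ∑ us f + ∑ us g
  ∑-+ f g []       = refl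
  ∑-+ f g (u ∷ us) = trans (cong ((f u + g u) +_) (∑-+ f g us)) (lem (f u) (g u) _ _)
    where
    lem : ∀ a b c d → a + b + (c + d) ≡ (a + c) + (b + d)
    lem = solve-∀

  ∑-*ˡ : (c : ℤ) (f : I → ℤ) (us : List I) → ∑ us (λ u → c * f u) ≡ c * ∑ us f
  ∑-*ˡ c f []       = sym (ℤₚ.*-zeroʳ c)
  ∑-*ˡ c f (u ∷ us) = trans (cong (c * f u +_) (∑-*ˡ c f us)) (sym (ℤₚ.*-distribˡ-+ c (f u) (∑ us f)))

  ∑-*ʳ : (c : ℤ) (f : I → ℤ) (us : List I) → ∑ us (λ u → f u * c) ≡ ∑ us f * c
  ∑-*ʳ c f us = trans (∑-cong us (λ u → ℤₚ.*-comm (f u) c))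
                      (trans (∑-*ˡ c f us) (ℤₚ.*-comm c (∑ us f)))

  ∑-neg : (f : I → ℤ) (us : List I) → ∑ us (λ u → - f u) ≡ - ∑ us f
  ∑-neg f []       = refl
  ∑-neg f (u ∷ us) = trans (cong (- f u +_) (∑-neg f us)) (sym (ℤₚ.neg-distrib-+ (f u) (∑ us f)))

  ∑-minus : (f g : I → ℤ) (us : List I) → ∑ us (λ u → f u - g u) ≡ ∑ us f - ∑ us g
  ∑-minus f g us = trans (∑-+ f (λ u → - g u) us) (cong (∑ us f +_) (∑-neg g us))

  ∑-map : {J : Set} (c : J → I) (f : I → ℤ) (us : List J) → ∑ (map c us) f ≡ ∑ us (f ∘ c)
  ∑-map c f us = cong (foldr _+_ 0ℤ) (sym (Listₚ.map-∘ us))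

  ∑-mono : {f g : I → ℤ} (us : List I) → (∀ u → f u ℤ.≤ g u) → ∑ us f ℤ.≤ ∑ us g
  ∑-mono []       le = ℤₚ.≤-refl
  ∑-mono (u ∷ us) le = ℤₚ.+-mono-≤ (le u) (∑-mono us le)

  ∑-swap : {J : Set} (f : I → J → ℤ) (us : List I) (vs : List J) →
           ∑ us (λ u → ∑ vs (f u)) ≡ ∑ vs (λ v → ∑ us (λ u → f u v))
  ∑-swap f []       vs = sym (∑0 vs)
    where
    ∑0 : ∀ vs → ∑ vs (λ _ → 0ℤ) ≡ 0ℤ
    ∑0 []       = refl
    ∑0 (_ ∷ vs) = cong (0ℤ +_) (∑0 vs)
  ∑-swap f (u ∷ us) vs = trans (cong (∑ vs (f u) +_) (∑-swap f us vs)) (sym (+′ vs))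
    where
    lem : ∀ a b c d → a + b + (c + d) ≡ (a + c) + (b + d)
    lem = solve-∀
    +′ : ∀ vs → ∑ vs (λ v → f u v + ∑ us (λ u′ → f u′ v)) ≡ ∑ vs (f u) + ∑ vs (λ v → ∑ us (λ u′ → f u′ v))
    +′ []       = refl
    +′ (v ∷ vs) = trans (cong ((f u v + ∑ us (λ u′ → f u′ v)) +_) (+′ vs)) (lem (f u v) _ _ _)

∑Fin : ∀ {k} → (Fin k → ℤ) → ℤ
∑Fin {k} = ∑ (allFin k)

∑-suc : ∀ {k} (f : Fin (suc k) → ℤ) → ∑Fin f ≡ f zero + ∑Fin (f ∘ suc)
∑-suc f = cong (λ l → f zero + foldr _+_ 0ℤ l)
  (trans (Listₚ.map-tabulate suc f) (sym (Listₚ.map-tabulate id (f ∘ suc))))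

∑-punchIn : ∀ {k} (f : Fin (suc k) → ℤ) (s : Fin (suc k)) → ∑Fin f ≡ f s + ∑Fin (f ∘ punchIn s)
∑-punchIn {k}     f zero    = ∑-suc f
∑-punchIn {suc k} f (suc s) = begin
  ∑Fin f                                                  ≡⟨ ∑-suc f ⟩
  f zero + ∑Fin (f ∘ suc)                                 ≡⟨ cong (f zero +_) (∑-punchIn (f ∘ suc) s) ⟩
  f zero + (f (suc s) + ∑Fin (f ∘ suc ∘ punchIn s))       ≡⟨ lem (f zero) (f (suc s)) _ ⟩
  f (suc s) + (f zero + ∑Fin (f ∘ suc ∘ punchIn s))       ≡⟨ cong (f (suc s) +_) (∑-suc (f ∘ punchIn (suc s))) ⟨
  f (suc s) + ∑Fin (f ∘ punchIn (suc s))                  ∎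
  where
  open ≡-Reasoning
  lem : ∀ a b c → a + (b + c) ≡ b + (a + c)
  lem = solve-∀

suc-≟ : ∀ {k} (u w : Fin k) → ⌊ suc u ≟ suc w ⌋ ≡ ⌊ u ≟ w ⌋
suc-≟ u w with u ≟ w
... | yes _ = refl
... | no _  = refl

∑-δ : ∀ {k} (f : Fin k → ℤ) (w : Fin k) → ∑Fin (λ u → f u * ind ⌊ u ≟ w ⌋) ≡ f w
∑-δ {suc k} f zero = begin
  _                                           ≡⟨ ∑-suc (λ u → f u * ind ⌊ u ≟ zero ⌋) ⟩
  f zero * 1ℤ + ∑Fin (λ u → f (suc u) * 0ℤ)   ≡⟨ cong₂ _+_ (ℤₚ.*-identityʳ (f zero)) (∑-0 (allFin k) (λ u → ℤₚ.*-zeroʳ (f (suc u)))) ⟩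
  f zero + 0ℤ                                 ≡⟨ ℤₚ.+-identityʳ (f zero) ⟩
  f zero                                      ∎
  where open ≡-Reasoning
∑-δ {suc k} f (suc w) = begin
  _                                           ≡⟨ ∑-suc (λ u → f u * ind ⌊ u ≟ suc w ⌋) ⟩
  f zero * 0ℤ + ∑Fin (λ u → f (suc u) * ind ⌊ suc u ≟ suc w ⌋)
    ≡⟨ cong₂ _+_ (ℤₚ.*-zeroʳ (f zero)) (∑-cong (allFin k) (λ u → cong (λ b → f (suc u) * ind b) (suc-≟ u w))) ⟩
  0ℤ + ∑Fin (λ u → f (suc u) * ind ⌊ u ≟ w ⌋) ≡⟨ ℤₚ.+-identityˡ _ ⟩
  ∑Fin (λ u → f (suc u) * ind ⌊ u ≟ w ⌋)      ≡⟨ ∑-δ (f ∘ suc) w ⟩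
  f (suc w)                                   ∎
  where open ≡-Reasoning

≟-refl : ∀ {k} (u : Fin k) → ⌊ u ≟ u ⌋ ≡ true
≟-refl u with u ≟ u
... | yes _ = refl
... | no ¬p with () ← ¬p refl

≟-≢ : ∀ {k} {u w : Fin k} → u ≢ w → ⌊ u ≟ w ⌋ ≡ false
≟-≢ {u = u} {w} u≢w with u ≟ w
... | yes p with () ← u≢w p
... | no _ = refl

≟-sym : ∀ {k} (u w : Fin k) → ⌊ u ≟ w ⌋ ≡ ⌊ w ≟ u ⌋
≟-sym u w with u ≟ w
... | yes refl = sym (≟-refl u)
... | no u≢w   = sym (≟-≢ (u≢w ∘ sym))

∑-δ′ : ∀ {k} (f : Fin k → ℤ) (w : Fin k) → ∑Fin (λ u → f u * ind ⌊ w ≟ u ⌋) ≡ f w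
∑-δ′ {k} f w = trans (∑-cong (allFin k) (λ u → cong (λ b → f u * ind b) (≟-sym w u))) (∑-δ f w)

-- Alternating forms and determinants

infixl 6 _⊕_
infixl 7 _⊙_

_⊕_ : ∀ {m} → Vec ℤ m → Vec ℤ m → Vec ℤ m
_⊕_ = Vec.zipWith _+_

_⊙_ : ∀ {m} → ℤ → Vec ℤ m → Vec ℤ m
k ⊙ x = Vec.map (k *_) x

0ᵛ : ∀ {m} → Vec ℤ m
0ᵛ = Vec.replicate _ 0ℤ

lookup-ext : ∀ {m} {x y : Vec ℤ m} → (∀ i → lookup x i ≡ lookup y i) → x ≡ y
lookup-ext {x = x} {y} eq =
  trans (sym (Vecₚ.tabulate∘lookup x)) (trans (Vecₚ.tabulate-cong eq) (Vecₚ.tabulate∘lookup y))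

lookup-0ᵛ : ∀ {m} (i : Fin m) → lookup 0ᵛ i ≡ 0ℤ
lookup-0ᵛ i = Vecₚ.lookup-replicate i 0ℤ

lookup-lin : ∀ {m} k (x y : Vec ℤ m) i → lookup (k ⊙ x ⊕ y) i ≡ k * lookup x i + lookup y i
lookup-lin k x y i = trans (Vecₚ.lookup-zipWith _+_ i (k ⊙ x) y) (cong (_+ lookup y i) (Vecₚ.lookup-map i (k *_) x))

Linear : ∀ {m} → (Vec ℤ m → ℤ) → Set
Linear h = ∀ k x y → h (k ⊙ x ⊕ y) ≡ k * h x + h y

-- The arguments form a list of arbitrary length, so that `fix` and `expand`, which change the
-- number of arguments, stay within one type. Vanishing is demanded only for equal neighbours; with
-- linearity this yields `swap`, by which any argument can be moved anywhere.
record AltForm {m} (F : List (Vec ℤ m) → ℤ) : Set where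
  field
    lin : ∀ a k x y b → F (a ++ (k ⊙ x ⊕ y) ∷ b) ≡ k * F (a ++ x ∷ b) + F (a ++ y ∷ b)
    alt : ∀ a x b → F (a ++ x ∷ x ∷ b) ≡ 0ℤ

  lin-zero : ∀ a b → F (a ++ 0ᵛ ∷ b) ≡ 0ℤ
  lin-zero a b = trans (cong (λ z → F (a ++ z ∷ b)) 0ᵛ-lin) (trans (lin a -1ℤ 0ᵛ 0ᵛ b) (lem (F (a ++ 0ᵛ ∷ b))))
    where
    lem : ∀ z → -1ℤ * z + z ≡ 0ℤ
    lem = solve-∀
    0ᵛ-lin : 0ᵛ ≡ -1ℤ ⊙ 0ᵛ ⊕ 0ᵛ
    0ᵛ-lin = lookup-ext (λ i → sym (trans (lookup-lin -1ℤ 0ᵛ 0ᵛ i) (trans (lem (lookup 0ᵛ i)) (sym (lookup-0ᵛ i)))))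

  lin-+ : ∀ a x y b → F (a ++ (x ⊕ y) ∷ b) ≡ F (a ++ x ∷ b) + F (a ++ y ∷ b)
  lin-+ a x y b = begin
    F (a ++ (x ⊕ y) ∷ b)                       ≡⟨ cong (λ z → F (a ++ (z ⊕ y) ∷ b)) 1⊙ ⟨
    F (a ++ (1ℤ ⊙ x ⊕ y) ∷ b)                  ≡⟨ lin a 1ℤ x y b ⟩
    1ℤ * F (a ++ x ∷ b) + F (a ++ y ∷ b)       ≡⟨ cong (_+ F (a ++ y ∷ b)) (ℤₚ.*-identityˡ (F (a ++ x ∷ b))) ⟩
    F (a ++ x ∷ b) + F (a ++ y ∷ b)            ∎
    where
    open ≡-Reasoning
    1⊙ : 1ℤ ⊙ x ≡ x
    1⊙ = trans (Vecₚ.map-cong ℤₚ.*-identityˡ x) (Vecₚ.map-id x)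

  -- Polarization: `x ⊕ y` is placed in both slots and the result, which is 0, is expanded.
  swap : ∀ a x y b → F (a ++ x ∷ y ∷ b) ≡ - F (a ++ y ∷ x ∷ b)
  swap a x y b = lem₂ xy yx (begin
    0ℤ                                               ≡⟨ alt a (x ⊕ y) b ⟨
    F (a ++ (x ⊕ y) ∷ (x ⊕ y) ∷ b)                   ≡⟨ lin-+ a x y ((x ⊕ y) ∷ b) ⟩
    F (a ++ x ∷ (x ⊕ y) ∷ b) + F (a ++ y ∷ (x ⊕ y) ∷ b)
      ≡⟨ cong₂ _+_ (second x) (second y) ⟩
    (F (a ++ x ∷ x ∷ b) + xy) + (yx + F (a ++ y ∷ y ∷ b))
      ≡⟨ cong₂ (λ s t → (s + xy) + (yx + t)) (alt a x b) (alt a y b) ⟩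
    (0ℤ + xy) + (yx + 0ℤ)                            ≡⟨ lem₁ xy yx ⟩
    xy + yx                                          ∎)
    where
    open ≡-Reasoning
    xy = F (a ++ x ∷ y ∷ b)
    yx = F (a ++ y ∷ x ∷ b)
    lem₁ : ∀ s t → (0ℤ + s) + (t + 0ℤ) ≡ s + t
    lem₁ = solve-∀
    lem₂ : ∀ s t → 0ℤ ≡ s + t → s ≡ - t
    lem₂ s t eq = trans (lem s t) (trans (cong (_- t) (sym eq)) (ℤₚ.+-identityˡ (- t)))
      where
      lem : ∀ s t → s ≡ (s + t) - t
      lem = solve-∀
    second : ∀ z → F (a ++ z ∷ (x ⊕ y) ∷ b) ≡ F (a ++ z ∷ x ∷ b) + F (a ++ z ∷ y ∷ b)
    second z = begin
      F (a ++ z ∷ (x ⊕ y) ∷ b)             ≡⟨ cong F (Listₚ.++-assoc a (z ∷ []) _) ⟨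
      F ((a ++ z ∷ []) ++ (x ⊕ y) ∷ b)     ≡⟨ lin-+ (a ++ z ∷ []) x y b ⟩
      _                                    ≡⟨ cong₂ _+_ (cong F (Listₚ.++-assoc a (z ∷ []) _)) (cong F (Listₚ.++-assoc a (z ∷ []) _)) ⟩
      F (a ++ z ∷ x ∷ b) + F (a ++ z ∷ y ∷ b) ∎

open AltForm

module _ {m : ℕ} {F : List (Vec ℤ m) → ℤ} where

  fix : AltForm F → ∀ x → AltForm (F ∘ (x ∷_))
  fix A x .lin a = lin A (x ∷ a)
  fix A x .alt a = alt A (x ∷ a)

  map-form : ∀ {l} (L : Vec ℤ l → Vec ℤ m) → (∀ k x y → L (k ⊙ x ⊕ y) ≡ k ⊙ L x ⊕ L y) →
             AltForm F → AltForm (F ∘ map L)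
  map-form L L-lin A .lin a k x y b = begin
    F (map L (a ++ (k ⊙ x ⊕ y) ∷ b))             ≡⟨ cong F (Listₚ.map-++ L a _) ⟩
    F (map L a ++ L (k ⊙ x ⊕ y) ∷ map L b)       ≡⟨ cong (λ z → F (map L a ++ z ∷ map L b)) (L-lin k x y) ⟩
    F (map L a ++ (k ⊙ L x ⊕ L y) ∷ map L b)     ≡⟨ lin A (map L a) k (L x) (L y) (map L b) ⟩
    _                                            ≡⟨ cong₂ (λ s t → k * F s + F t) (Listₚ.map-++ L a _) (Listₚ.map-++ L a _) ⟨
    k * F (map L (a ++ x ∷ b)) + F (map L (a ++ y ∷ b)) ∎
    where open ≡-Reasoning
  map-form L L-lin A .alt a x b = trans (cong F (Listₚ.map-++ L a _)) (alt A (map L a) (L x) (map L b))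

-- The sign of the cyclic permutation that carries one entry past the whole list.
sgn : {X : Set} → List X → ℤ
sgn []      = 1ℤ
sgn (_ ∷ l) = - sgn l

to-front : ∀ {m} {F : List (Vec ℤ m) → ℤ} → AltForm F →
           ∀ p x b → F (p ++ x ∷ b) ≡ sgn p * F (x ∷ p ++ b)
to-front         A []      x b = sym (ℤₚ.*-identityˡ _)
to-front {F = F} A (y ∷ p) x b = begin
  F (y ∷ p ++ x ∷ b)                 ≡⟨ to-front (fix A y) p x b ⟩
  sgn p * F (y ∷ x ∷ p ++ b)         ≡⟨ cong (sgn p *_) (swap A [] y x (p ++ b)) ⟩
  sgn p * - F (x ∷ y ∷ p ++ b)       ≡⟨ lem (sgn p) _ ⟩
  - sgn p * F (x ∷ y ∷ p ++ b)       ∎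
  where
  open ≡-Reasoning
  lem : ∀ s t → s * - t ≡ - s * t
  lem = solve-∀

sgn*sgn : {X : Set} (p : List X) → sgn p * sgn p ≡ 1ℤ
sgn*sgn []      = refl
sgn*sgn (_ ∷ p) = trans (lem (sgn p)) (sgn*sgn p)
  where
  lem : ∀ s → - s * - s ≡ s * s
  lem = solve-∀

from-front : ∀ {m} {F : List (Vec ℤ m) → ℤ} → AltForm F →
             ∀ p x b → F (x ∷ p ++ b) ≡ sgn p * F (p ++ x ∷ b)
from-front {F = F} A p x b = begin
  F (x ∷ p ++ b)                     ≡⟨ ℤₚ.*-identityˡ _ ⟨
  1ℤ * F (x ∷ p ++ b)                ≡⟨ cong (_* F (x ∷ p ++ b)) (sgn*sgn p) ⟨
  sgn p * sgn p * F (x ∷ p ++ b)     ≡⟨ ℤₚ.*-assoc (sgn p) (sgn p) _ ⟩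
  sgn p * (sgn p * F (x ∷ p ++ b))   ≡⟨ cong (sgn p *_) (to-front A p x b) ⟨
  sgn p * F (p ++ x ∷ b)             ∎
  where open ≡-Reasoning

-- Signed expansion of F along the functional h; for h a coordinate and F a
-- determinant this is Laplace expansion.
expand : ∀ {m} → (Vec ℤ m → ℤ) → (List (Vec ℤ m) → ℤ) → List (Vec ℤ m) → ℤ
expand h F []       = 0ℤ
expand h F (x ∷ xs) = h x * F xs - expand h (F ∘ (x ∷_)) xs

module _ {m : ℕ} (h : Vec ℤ m → ℤ) where

  expand-cong : ∀ {F G : List (Vec ℤ m) → ℤ} → (∀ xs → F xs ≡ G xs) → ∀ xs → expand h F xs ≡ expand h G xs
  expand-cong eq []       = refl
  expand-cong eq (x ∷ xs) = cong₂ (λ s t → h x * s - t) (eq xs) (expand-cong (eq ∘ (x ∷_)) xs)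

  expand-0 : ∀ {F : List (Vec ℤ m) → ℤ} → (∀ xs → F xs ≡ 0ℤ) → ∀ xs → expand h F xs ≡ 0ℤ
  expand-0 eq []       = refl
  expand-0 eq (x ∷ xs) = trans (cong₂ (λ s t → h x * s - t) (eq xs) (expand-0 (eq ∘ (x ∷_)) xs)) (lem (h x))
    where
    lem : ∀ s → s * 0ℤ - 0ℤ ≡ 0ℤ
    lem = solve-∀

  expand-lin : ∀ k (F G : List (Vec ℤ m) → ℤ) xs →
               expand h (λ ys → k * F ys + G ys) xs ≡ k * expand h F xs + expand h G xs
  expand-lin k F G []       = sym (trans (ℤₚ.+-identityʳ _) (ℤₚ.*-zeroʳ k))
  expand-lin k F G (x ∷ xs) =
    trans (cong (λ t → h x * (k * F xs + G xs) - t) (expand-lin k (F ∘ (x ∷_)) (G ∘ (x ∷_)) xs))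
          (lem (h x) k (F xs) (G xs) _ _)
    where
    lem : ∀ c k f g s t → c * (k * f + g) - (k * s + t) ≡ k * (c * f - s) + (c * g - t)
    lem = solve-∀

  -- For two equal leading arguments the two leading terms cancel, and every other term still
  -- contains both copies of x.
  expand-form : Linear h → ∀ {F} → AltForm F → AltForm (expand h F)
  expand-form h-lin {F} A .lin [] k x y b = begin
    h (k ⊙ x ⊕ y) * F b - expand h (F ∘ ((k ⊙ x ⊕ y) ∷_)) b
      ≡⟨ cong₂ (λ s t → s * F b - t) (h-lin k x y)
           (trans (expand-cong (lin A [] k x y) b) (expand-lin k (F ∘ (x ∷_)) (F ∘ (y ∷_)) b)) ⟩
    (k * h x + h y) * F b - (k * expand h (F ∘ (x ∷_)) b + expand h (F ∘ (y ∷_)) b)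
      ≡⟨ lem k (h x) (h y) (F b) _ _ ⟩
    k * expand h F (x ∷ b) + expand h F (y ∷ b) ∎
    where
    open ≡-Reasoning
    lem : ∀ k p q f s t → (k * p + q) * f - (k * s + t) ≡ k * (p * f - s) + (q * f - t)
    lem = solve-∀
  expand-form h-lin {F} A .lin (z ∷ a) k x y b = begin
    h z * F (a ++ (k ⊙ x ⊕ y) ∷ b) - expand h (F ∘ (z ∷_)) (a ++ (k ⊙ x ⊕ y) ∷ b)
      ≡⟨ cong₂ (λ s t → h z * s - t) (lin A a k x y b) (lin (expand-form h-lin (fix A z)) a k x y b) ⟩
    _ ≡⟨ lem k (h z) _ _ _ _ ⟩
    k * expand h F (z ∷ a ++ x ∷ b) + expand h F (z ∷ a ++ y ∷ b) ∎
    where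
    open ≡-Reasoning
    lem : ∀ k p f g s t → p * (k * f + g) - (k * s + t) ≡ k * (p * f - s) + (p * g - t)
    lem = solve-∀
  expand-form h-lin {F} A .alt [] x b =
    trans (cong (λ t → h x * F (x ∷ b) - (h x * F (x ∷ b) - t)) (expand-0 (alt A [] x) b)) (lem (h x * F (x ∷ b)))
    where
    lem : ∀ s → s - (s - 0ℤ) ≡ 0ℤ
    lem = solve-∀
  expand-form h-lin {F} A .alt (z ∷ a) x b =
    trans (cong₂ (λ s t → h z * s - t) (alt A a x b) (alt (expand-form h-lin (fix A z)) a x b)) (lem (h z))
    where
    lem : ∀ s → s * 0ℤ - 0ℤ ≡ 0ℤ
    lem = solve-∀

  expand-kills : ∀ {F} {xs} → All (λ x → h x ≡ 0ℤ) xs → expand h F xs ≡ 0ℤ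
  expand-kills []           = refl
  expand-kills {F} {_ ∷ xs} (hx ∷ hxs) =
    trans (cong₂ (λ s t → s * F xs - t) hx (expand-kills hxs)) (lem (F xs))
    where
    lem : ∀ s → 0ℤ * s - 0ℤ ≡ 0ℤ
    lem = solve-∀

-- Laplace expansion along the first coordinate, the list entries being the columns. With these base
-- cases the value is 0 on every list whose length is not m.
det : (m : ℕ) → List (Vec ℤ m) → ℤ
det zero    []      = 1ℤ
det zero    (_ ∷ _) = 0ℤ
det (suc m)         = expand Vec.head (det m ∘ map Vec.tail)

det-form : ∀ m → AltForm (det m)
det-form zero .lin []      k x y b = sym (trans (ℤₚ.+-identityʳ _) (ℤₚ.*-zeroʳ k))
det-form zero .lin (_ ∷ _) k x y b = sym (trans (ℤₚ.+-identityʳ _) (ℤₚ.*-zeroʳ k))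
det-form zero .alt []      x b = refl
det-form zero .alt (_ ∷ _) x b = refl
det-form (suc m) = expand-form Vec.head (λ { k (_ ∷ _) (_ ∷ _) → refl })
  (map-form Vec.tail (λ { k (_ ∷ _) (_ ∷ _) → refl }) (det-form m))

-- Forms on spanned vectors and vanishing of determinants

lc : ∀ {m} {I : Set} → (I → Vec ℤ m) → (I → ℤ) → List I → Vec ℤ m
lc c g us = foldr _⊕_ 0ᵛ (map (λ u → g u ⊙ c u) us)

lookup-lc : ∀ {m} {I : Set} (c : I → Vec ℤ m) g us i → lookup (lc c g us) i ≡ ∑ us (λ u → g u * lookup (c u) i)
lookup-lc c g []       i = lookup-0ᵛ i
lookup-lc c g (u ∷ us) i = trans (lookup-lin (g u) (c u) (lc c g us) i) (cong (λ t → g u * lookup (c u) i + t) (lookup-lc c g us i))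

Span : ∀ {m} {I : Set} → (I → Vec ℤ m) → List I → Vec ℤ m → Set
Span c us x = ∃ λ g → x ≡ lc c g us

module _ (q : ℤ) where

  ∣0 : q ∣ 0ℤ
  ∣0 = divides 0ℤ refl

  -- In the multilinear expansion, terms containing c twice vanish. There remain the terms without c
  -- and those with a single c, which can be moved to the front up to sign.
  vanish-step : ∀ {m} {Q : Vec ℤ m → Set} c {F} → AltForm F → ∀ xs →
    All (λ x → ∃ λ k → ∃ λ y → Q y × x ≡ k ⊙ c ⊕ y) xs →
    (∀ ys → All Q ys → length ys ≡ length xs → q ∣ F ys) →
    (∀ ys → All Q ys → suc (length ys) ≡ length xs → q ∣ F (c ∷ ys)) →
    q ∣ F xs
  vanish-step c A []       []  q∣F q∣Fc = q∣F [] [] refl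
  vanish-step c {F} A (x ∷ xs) ((k , y , Qy , refl) ∷ qs) q∣F q∣Fc =
    subst (q ∣_) (sym (lin A [] k c y xs)) (∣m∣n⇒∣m+n (∣n⇒∣m*n k with-c) with-y)
    where
    with-c : q ∣ F (c ∷ xs)
    with-c = vanish-step c (fix A c) xs qs
      (λ ys Qys len → q∣Fc ys Qys (cong suc len))
      (λ ys Qys len → subst (q ∣_) (sym (alt A [] c ys)) ∣0)
    with-y : q ∣ F (y ∷ xs)
    with-y = vanish-step c (fix A y) xs qs
      (λ ys Qys len → q∣F (y ∷ ys) (Qy ∷ Qys) (cong suc len))
      (λ ys Qys len → subst (q ∣_) (sym (swap A [] y c ys)) (∣m⇒∣-m (q∣Fc (y ∷ ys) (Qy ∷ Qys) (cong suc len))))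

  -- The vectors of the family are eliminated one at a time by `vanish-step`; each ends up inside or
  -- outside the sublist S. For q = 0 the conclusion says that F vanishes at xs.
  vanish : ∀ {m} {I : Set} (c : I → Vec ℤ m) us {F} → AltForm F → ∀ xs → All (Span c us) xs →
    (∀ S → S ⊆ us → length S ≡ length xs → q ∣ F (map c S)) → q ∣ F xs
  vanish c [] A []       sp q∣F = q∣F [] [] refl
  vanish c [] A (x ∷ xs) ((g , refl) ∷ sp) q∣F = subst (q ∣_) (sym (lin-zero A [] xs)) ∣0
  vanish c (u ∷ us) A xs sp q∣F = vanish-step (c u) A xs
    (All.map (λ { (g , eq) → g u , lc c g us , (g , refl) , eq }) sp)
    (λ ys sp′ len → vanish c us A ys sp′ (λ S S⊆ len′ → q∣F S (u ∷ʳ S⊆) (trans len′ len)))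
    (λ ys sp′ len → vanish c us (fix A (c u)) ys sp′
      (λ S S⊆ len′ → q∣F (u ∷ S) (refl ∷ S⊆) (trans (cong suc len′) len)))

𝐞 : ∀ {m} → Fin m → Vec ℤ m
𝐞 v = Vec.tabulate (λ u → ind ⌊ u ≟ v ⌋)

lookup-𝐞 : ∀ {m} (v u : Fin m) → lookup (𝐞 v) u ≡ ind ⌊ u ≟ v ⌋
lookup-𝐞 v u = Vecₚ.lookup∘tabulate _ u

𝐞-span : ∀ {m} (x : Vec ℤ m) → Span 𝐞 (allFin m) x
𝐞-span {m} x = lookup x , lookup-ext (λ i → sym (trans (lookup-lc 𝐞 (lookup x) (allFin m) i)
  (trans (∑-cong (allFin m) (λ u → cong (lookup x u *_) (lookup-𝐞 u i))) (∑-δ′ (lookup x) i))))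

length-allFin : ∀ k → length (allFin k) ≡ k
length-allFin k = Listₚ.length-tabulate id

-- All arguments are combinations of the m unit vectors, and `allFin m` has no sublist of length m +
-- 1, so `vanish` applies vacuously with q = 0.
form-0 : ∀ {m F} → AltForm {m} F → ∀ xs → length xs ≡ suc m → F xs ≡ 0ℤ
form-0 {m} A xs len with vanish 0ℤ 𝐞 (allFin m) A xs (All.universal 𝐞-span xs)
  (λ S S⊆ len′ → let le = Subₚ.length-mono-≤ S⊆ in
    ⊥-elim (ℕₚ.<-irrefl refl (subst₂ ℕ._≤_ (trans len′ len) (length-allFin m) le)))
... | divides k eq = trans eq (ℤₚ.*-zeroʳ k)

module _ {m : ℕ} {h : Vec ℤ m → ℤ} (h-lin : Linear h) where

  -- The expansion of `det m` along h is an alternating form, so it vanishes at the m + 1 vectors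
  -- `x ∷ xs`. Only the term of x survives, since h kills the others.
  det-annihilated : ∀ {xs} → length xs ≡ m → All (λ x → h x ≡ 0ℤ) xs → ∀ x → h x * det m xs ≡ 0ℤ
  det-annihilated {xs} len hxs x = begin
    h x * det m xs                ≡⟨ ℤₚ.+-identityʳ (h x * det m xs) ⟨
    h x * det m xs - 0ℤ           ≡⟨ cong (λ t → h x * det m xs - t) (expand-kills h hxs) ⟨
    expand h (det m) (x ∷ xs)     ≡⟨ form-0 (expand-form h h-lin (det-form m)) (x ∷ xs) (cong suc len) ⟩
    0ℤ                            ∎
    where open ≡-Reasoning

  det-kernel : ∀ {xs} → length xs ≡ m → All (λ x → h x ≡ 0ℤ) xs → ∀ x → h x ≡ 1ℤ → det m xs ≡ 0ℤ
  det-kernel {xs} len hxs x hx = trans (sym (ℤₚ.*-identityˡ _)) (trans (cong (_* det m xs) (sym hx)) (det-annihilated len hxs x))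

-- Cramer's rule and the determinant of the unit vectors

_[_≔_] : ∀ {k} {X : Set} → (Fin k → X) → Fin k → X → Fin k → X
(c [ w ≔ x ]) u = if ⌊ u ≟ w ⌋ then x else c u

module _ {k : ℕ} {X : Set} (c : Fin k → X) where

  ≔-same : ∀ w x → (c [ w ≔ x ]) w ≡ x
  ≔-same w x = cong (λ b → if b then x else c w) (≟-refl w)

  ≔-other : ∀ {u w} x → u ≢ w → (c [ w ≔ x ]) u ≡ c u
  ≔-other {u} x u≢w = cong (λ b → if b then x else c u) (≟-≢ u≢w)

  ≔-outside : ∀ {w us} x → All (w ≢_) us → map (c [ w ≔ x ]) us ≡ map c us
  ≔-outside x []       = refl
  ≔-outside x (w≢u ∷ w≢us) = cong₂ _∷_ (≔-other x (w≢u ∘ sym)) (≔-outside x w≢us)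

∑-congᴬ : {I : Set} {f g : I → ℤ} {us : List I} → All (λ u → f u ≡ g u) us → ∑ us f ≡ ∑ us g
∑-congᴬ []         = refl
∑-congᴬ (eq ∷ eqs) = cong₂ _+_ eq (∑-congᴬ eqs)

-- Moving x from the front into the slot of the omitted vector `c w` produces exactly the sign that
-- the expansion gives this term, so all signs cancel. Uniqueness of `us` ensures that the
-- replacement affects one slot only.
expand-replace : ∀ {m k} (h : Vec ℤ m → ℤ) (c : Fin k → Vec ℤ m) x {us} → Unique us → ∀ {F} → AltForm F →
  expand h (F ∘ (x ∷_)) (map c us) ≡ ∑ us (λ w → h (c w) * F (map (c [ w ≔ x ]) us))
expand-replace h c x []  A = refl
expand-replace h c x {u ∷ us} (u≢us ∷ uniq) {F} A = begin
  h (c u) * F (x ∷ map c us) - expand h (λ l → F (x ∷ c u ∷ l)) (map c us)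
    ≡⟨ cong (λ t → h (c u) * F (x ∷ map c us) - t)
         (trans (expand-cong h (λ l → trans (swap A [] x (c u) l) (neg _)) (map c us))
                (expand-lin h -1ℤ (λ l → F (c u ∷ x ∷ l)) (λ _ → 0ℤ) (map c us))) ⟩
  h (c u) * F (x ∷ map c us) - (-1ℤ * expand h (λ l → F (c u ∷ x ∷ l)) (map c us) + expand h (λ _ → 0ℤ) (map c us))
    ≡⟨ cong₂ (λ s t → h (c u) * F (x ∷ map c us) - (-1ℤ * s + t)) (expand-replace h c x uniq (fix A (c u))) (expand-0 h (λ _ → refl) (map c us)) ⟩
  h (c u) * F (x ∷ map c us) - (-1ℤ * ∑ us (λ w → h (c w) * F (c u ∷ map (c [ w ≔ x ]) us)) + 0ℤ)
    ≡⟨ lem (h (c u) * F (x ∷ map c us)) _ ⟩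
  h (c u) * F (x ∷ map c us) + ∑ us (λ w → h (c w) * F (c u ∷ map (c [ w ≔ x ]) us))
    ≡⟨ cong₂ _+_ (cong₂ (λ y ys → h (c u) * F (y ∷ ys)) (≔-same c u x) (≔-outside c x u≢us))
         (∑-congᴬ (All.map (λ {w} u≢w → cong (λ y → h (c w) * F (y ∷ map (c [ w ≔ x ]) us)) (≔-other c x u≢w)) u≢us)) ⟨
  _ ∎
  where
  open ≡-Reasoning
  neg : ∀ s → - s ≡ -1ℤ * s + 0ℤ
  neg = solve-∀
  lem : ∀ s t → s - (-1ℤ * t + 0ℤ) ≡ s + t
  lem = solve-∀

-- The expansion along h vanishes at the m + 1 vectors x and `c w`; the term of x is one side and
-- `expand-replace` evaluates the others. With h a coordinate this is Cramer's rule without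
-- division.
cramer : ∀ {m} {h : Vec ℤ m → ℤ} → Linear h → ∀ (c : Fin m → Vec ℤ m) x →
  h x * det m (map c (allFin m)) ≡ ∑Fin (λ w → h (c w) * det m (map (c [ w ≔ x ]) (allFin m)))
cramer {m} {h} h-lin c x = trans
  (ℤₚ.i-j≡0⇒i≡j _ _ (form-0 (expand-form h h-lin (det-form m)) (x ∷ map c (allFin m))
    (cong suc (trans (Listₚ.length-map c (allFin m)) (length-allFin m)))))
  (expand-replace h c x (allFin⁺ m) (det-form m))

lookup-linear : ∀ {m} (i : Fin m) → Linear (λ x → lookup x i)
lookup-linear i k x y = lookup-lin k x y i

det-first : ∀ m xs → det (suc m) ((1ℤ ∷ 0ᵛ) ∷ xs) ≡ det m (map Vec.tail xs)
det-first m xs = trans (cong (λ t → 1ℤ * det m (map Vec.tail xs) - t)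
    (expand-0 Vec.head (λ l → lin-zero (det-form m) [] (map Vec.tail l)) xs)) (lem _)
  where
  lem : ∀ s → 1ℤ * s - 0ℤ ≡ s
  lem = solve-∀

𝐞-zero : ∀ {m} → 𝐞 {suc m} zero ≡ 1ℤ ∷ 0ᵛ
𝐞-zero {m} = cong (1ℤ ∷_) (lookup-ext λ i → trans (Vecₚ.lookup∘tabulate _ i) (sym (lookup-0ᵛ i)))

tail-𝐞 : ∀ {m} (v : Fin m) → Vec.tail (𝐞 (suc v)) ≡ 𝐞 v
tail-𝐞 v = Vecₚ.tabulate-cong (λ u → cong ind (suc-≟ u v))

det-𝐞 : ∀ m → det m (map 𝐞 (allFin m)) ≡ 1ℤ
det-𝐞 zero    = refl
det-𝐞 (suc m) = begin
  det (suc m) (𝐞 zero ∷ map 𝐞 (tabulate suc))    ≡⟨ cong (λ z → det (suc m) (z ∷ map 𝐞 (tabulate suc))) 𝐞-zero ⟩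
  det (suc m) ((1ℤ ∷ 0ᵛ) ∷ map 𝐞 (tabulate suc)) ≡⟨ det-first m (map 𝐞 (tabulate suc)) ⟩
  det m (map Vec.tail (map 𝐞 (tabulate suc)))    ≡⟨ cong (det m) (trans (cong (map Vec.tail) (Listₚ.map-tabulate suc 𝐞)) (Listₚ.map-tabulate (𝐞 ∘ suc) Vec.tail)) ⟩
  det m (tabulate (Vec.tail ∘ 𝐞 ∘ suc))          ≡⟨ cong (det m) (Listₚ.tabulate-cong tail-𝐞) ⟩
  det m (tabulate 𝐞)                             ≡⟨ cong (det m) (Listₚ.map-tabulate id 𝐞) ⟨
  det m (map 𝐞 (allFin m))                       ≡⟨ det-𝐞 m ⟩
  1ℤ                                             ∎
  where open ≡-Reasoning

-- Oriented forests

unique-++⁻ : {X : Set} (a : List X) {x : X} {b : List X} → Unique (a ++ x ∷ b) → All (x ≢_) a × All (x ≢_) b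
unique-++⁻ []      (x≢b ∷ _)  = [] , x≢b
unique-++⁻ (y ∷ a) (y≢ ∷ uniq) with unique-++⁻ a uniq
... | x≢a , x≢b = (All.lookup y≢ (∈-++⁺ʳ a (here refl)) ∘ sym) ∷ x≢a , x≢b

allFin-split : ∀ {k} (w : Fin k) → ∃ λ a → ∃ λ b → allFin k ≡ a ++ w ∷ b × All (w ≢_) a × All (w ≢_) b
allFin-split {k} w with ∈-∃++ (∈-allFin w)
... | a , b , eq = a , b , eq , unique-++⁻ a (subst Unique eq (allFin⁺ k))

module _ {m k : ℕ} {F : List (Vec ℤ m) → ℤ} (A : AltForm F) (c : Fin k → Vec ℤ m) where

  map-≔ : ∀ {w a b} x → All (w ≢_) a → All (w ≢_) b → map (c [ w ≔ x ]) (a ++ w ∷ b) ≡ map c a ++ x ∷ map c b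
  map-≔ {w} {a} {b} x w≢a w≢b = trans (Listₚ.map-++ _ a _)
    (cong₂ _++_ (≔-outside c x w≢a) (cong₂ _∷_ (≔-same c w x) (≔-outside c x w≢b)))

  ≔-lin : ∀ w s x y → F (map (c [ w ≔ s ⊙ x ⊕ y ]) (allFin k)) ≡
          s * F (map (c [ w ≔ x ]) (allFin k)) + F (map (c [ w ≔ y ]) (allFin k))
  ≔-lin w s x y with allFin-split w
  ... | a , b , eq , w≢a , w≢b rewrite eq | map-≔ (s ⊙ x ⊕ y) w≢a w≢b | map-≔ x w≢a w≢b | map-≔ y w≢a w≢b =
    lin A (map c a) s x y (map c b)

  zero-entry : ∀ w → c w ≡ 0ᵛ → F (map c (allFin k)) ≡ 0ℤ
  zero-entry w cw≡0 with allFin-split w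
  ... | a , b , eq , _ = trans (cong F (trans (cong (map c) eq) (trans (Listₚ.map-++ c a _) (cong (λ z → map c a ++ z ∷ map c b) cw≡0))))
    (lin-zero A (map c a) (map c b))

module _ {m : ℕ} (φ : Fin m → ℤ) where

  dot : Vec ℤ m → ℤ
  dot x = ∑Fin (λ v → φ v * lookup x v)

  dot-linear : Linear dot
  dot-linear k x y = begin
    ∑Fin (λ v → φ v * lookup (k ⊙ x ⊕ y) v)                   ≡⟨ ∑-cong (allFin m) (λ v → trans (cong (φ v *_) (lookup-lin k x y v)) (lem (φ v) k _ _)) ⟩
    ∑Fin (λ v → k * (φ v * lookup x v) + φ v * lookup y v)    ≡⟨ ∑-+ (λ v → k * (φ v * lookup x v)) (λ v → φ v * lookup y v) (allFin m) ⟩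
    ∑Fin (λ v → k * (φ v * lookup x v)) + dot y               ≡⟨ cong (_+ dot y) (∑-*ˡ k (λ v → φ v * lookup x v) (allFin m)) ⟩
    k * dot x + dot y                                         ∎
    where
    open ≡-Reasoning
    lem : ∀ p k a b → p * (k * a + b) ≡ k * (p * a) + p * b
    lem = solve-∀

  dot-𝐞 : ∀ v → dot (𝐞 v) ≡ φ v
  dot-𝐞 v = trans (∑-cong (allFin m) (λ u → cong (φ u *_) (lookup-𝐞 v u))) (∑-δ φ v)

  dot-edge : ∀ {u v} → φ u ≡ φ v → dot (-1ℤ ⊙ 𝐞 v ⊕ 𝐞 u) ≡ 0ℤ
  dot-edge {u} {v} eq = begin
    dot (-1ℤ ⊙ 𝐞 v ⊕ 𝐞 u)           ≡⟨ dot-linear -1ℤ (𝐞 v) (𝐞 u) ⟩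
    -1ℤ * dot (𝐞 v) + dot (𝐞 u)     ≡⟨ cong₂ (λ s t → -1ℤ * s + t) (dot-𝐞 v) (trans (dot-𝐞 u) eq) ⟩
    -1ℤ * φ v + φ v                 ≡⟨ lem (φ v) ⟩
    0ℤ                              ∎
    where
    open ≡-Reasoning
    lem : ∀ z → -1ℤ * z + z ≡ 0ℤ
    lem = solve-∀

  -- The criterion for all vanishing determinants below. The weights φ will be indicators of vertex
  -- sets closed under following arrows in both directions, or the constant 1 for columns of total
  -- 0.
  det-dot : {c : Fin m → Vec ℤ m} → (∀ u → dot (c u) ≡ 0ℤ) → ∀ z → φ z ≡ 1ℤ → det m (map c (allFin m)) ≡ 0ℤ
  det-dot {c} φc z φz = det-kernel dot-linear (trans (Listₚ.length-map c (allFin m)) (length-allFin m))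
    (Allₚ.map⁺ (All.universal φc (allFin m))) (𝐞 z) (trans (dot-𝐞 z) φz)

module _ {N : ℕ} (G : Graph N) where

  iter-+ : ∀ j k (f : Fin N → Fin N) u → iter G (j ℕ.+ k) f u ≡ iter G k f (iter G j f u)
  iter-+ zero    k f u = refl
  iter-+ (suc j) k f u = iter-+ j k f (f u)

  iter-fixed : ∀ k (f : Fin N → Fin N) {u} → f u ≡ u → iter G k f u ≡ u
  iter-fixed zero    f fu = refl
  iter-fixed (suc k) f fu = trans (cong (iter G k f) fu) (iter-fixed k f fu)

  iter-comm : ∀ k (f : Fin N → Fin N) u → iter G k f (f u) ≡ f (iter G k f u)
  iter-comm zero    f u = refl
  iter-comm (suc k) f u = iter-comm k f (f u)

  iter-* : ∀ i j (f : Fin N → Fin N) {u} → iter G j f u ≡ u → iter G (i ℕ.* j) f u ≡ u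
  iter-* zero    j f eq = refl
  iter-* (suc i) j f {u} eq = trans (iter-+ j (i ℕ.* j) f u) (trans (cong (iter G (i ℕ.* j) f) eq) (iter-* i j f eq))

  -- By the pigeonhole principle an orbit that has not met the fixed point w in N steps never does.
  iter-saturates : ∀ (f : Fin N → Fin N) {w} → f w ≡ w → ∀ u → iter G N f (f u) ≡ w → iter G N f u ≡ w
  iter-saturates f {w} fw u eq with Finₚ.pigeonhole (ℕₚ.n<1+n N) (λ i → iter G (Fin.toℕ i) f u)
  ... | i , j , i<j , fi≡fj = begin
    iter G N f u                          ≡⟨ cong (λ k → iter G k f u) (ℕₚ.m+[n∸m]≡n i+r≤N) ⟨
    iter G ((i′ ℕ.+ r) ℕ.+ (N ℕ.∸ (i′ ℕ.+ r))) f u ≡⟨ iter-+ (i′ ℕ.+ r) (N ℕ.∸ (i′ ℕ.+ r)) f u ⟩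
    iter G (N ℕ.∸ (i′ ℕ.+ r)) f (iter G (i′ ℕ.+ r) f u) ≡⟨ cong (iter G (N ℕ.∸ (i′ ℕ.+ r)) f) hit ⟩
    iter G (N ℕ.∸ (i′ ℕ.+ r)) f w          ≡⟨ iter-fixed (N ℕ.∸ (i′ ℕ.+ r)) f fw ⟩
    w                                     ∎
    where
    open ≡-Reasoning
    i′ = Fin.toℕ i
    j′ = Fin.toℕ j
    j′≤1+N : j′ ℕ.≤ suc N
    j′≤1+N = ℕₚ.<⇒≤ (Finₚ.toℕ<n j)
    r = suc N ℕ.∸ j′
    i+r≤N : i′ ℕ.+ r ℕ.≤ N
    i+r≤N = ℕₚ.≤-pred (subst (suc (i′ ℕ.+ r) ℕ.≤_) (ℕₚ.m+[n∸m]≡n j′≤1+N) (ℕₚ.+-monoˡ-≤ r i<j))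
    hit : iter G (i′ ℕ.+ r) f u ≡ w
    hit = begin
      iter G (i′ ℕ.+ r) f u          ≡⟨ iter-+ i′ r f u ⟩
      iter G r f (iter G i′ f u)     ≡⟨ cong (iter G r f) fi≡fj ⟩
      iter G r f (iter G j′ f u)     ≡⟨ iter-+ j′ r f u ⟨
      iter G (j′ ℕ.+ r) f u          ≡⟨ cong (λ k → iter G k f u) (ℕₚ.m+[n∸m]≡n j′≤1+N) ⟩
      iter G (suc N) f u            ≡⟨ eq ⟩
      w                             ∎

  -- p u is the target of the arrow out of u, and nothing if u is a root.
  next : (Fin N → Maybe (Fin N)) → Fin N → Fin N
  next p u = maybe id u (p u)

  arrow : (Fin N → Maybe (Fin N)) → Fin N → Vec ℤ N
  arrow p u = maybe (λ v → -1ℤ ⊙ 𝐞 v ⊕ 𝐞 u) (𝐞 u) (p u)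

  -- The indicator of the vertices whose orbit avoids w is constant along arrows and 0 at w, the
  -- only root. So it annihilates every column, while its value at z is 1.
  det-nontree : ∀ {p w} → p w ≡ nothing → (∀ u → u ≢ w → p u ≢ nothing) →
                ∀ z → iter G N (next p) z ≢ w → det N (map (arrow p) (allFin N)) ≡ 0ℤ
  det-nontree {p} {w} pw pu z z↛w = det-dot φ kills z (cong (λ b → ind (not b)) (≟-≢ z↛w))
    where
    φ : Fin N → ℤ
    φ v = ind (not ⌊ iter G N (next p) v ≟ w ⌋)
    next-w : next p w ≡ w
    next-w = cong (maybe id w) pw
    φ-next : ∀ u → φ u ≡ φ (next p u)
    φ-next u with iter G N (next p) u ≟ w | iter G N (next p) (next p u) ≟ w
    ... | yes _ | yes _ = refl
    ... | no _  | no _  = refl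
    ... | yes q | no ¬q = ⊥-elim (¬q (trans (iter-comm N (next p) u) (trans (cong (next p) q) next-w)))
    -- Here w is reached from u in N + 1 steps, one more than φ allows; saturation of orbits brings
    -- this back to N.
    ... | no ¬q | yes q = ⊥-elim (¬q (iter-saturates (next p) next-w u q))
    φw : φ w ≡ 0ℤ
    φw rewrite iter-fixed N (next p) next-w | ≟-refl w = refl
    kills : ∀ u → dot φ (arrow p u) ≡ 0ℤ
    kills u with p u in eq
    ... | just v = dot-edge φ (trans (φ-next u) (cong φ (cong (maybe id u) eq)))
    ... | nothing with u ≟ w
    ...   | yes refl = trans (dot-𝐞 φ w) φw
    ...   | no u≢w   = ⊥-elim (pu u u≢w eq)

  module _ {p : Fin N → Maybe (Fin N)} {w : Fin N} (pw : p w ≡ nothing) (tree : ∀ u → iter G N (next p) u ≡ w) where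

    _⊑p : (Fin N → Maybe (Fin N)) → Set
    q ⊑p = ∀ u → q u ≡ nothing ⊎ q u ≡ p u

    next-⊑ : ∀ {q} → q ⊑p → ∀ u → next q u ≡ u ⊎ next q u ≡ next p u
    next-⊑ q⊑p u with q⊑p u
    ... | inj₁ eq = inj₁ (cong (maybe id u) eq)
    ... | inj₂ eq = inj₂ (cong (maybe id u) eq)

    -- An orbit of the subforest q follows that of p until it meets a root of q, where it stays.
    iter-⊑ : ∀ {q} → q ⊑p → ∀ k u → next q (iter G k (next q) u) ≡ iter G k (next q) u ⊎ iter G k (next q) u ≡ iter G k (next p) u
    iter-⊑ q⊑p zero    u = inj₂ refl
    iter-⊑ {q} q⊑p (suc k) u with next-⊑ q⊑p u
    ... | inj₁ eq = inj₁ (trans (cong (next q) fixed) (trans eq (sym fixed)))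
      where
      fixed : iter G (suc k) (next q) u ≡ u
      fixed = iter-fixed (suc k) (next q) eq
    ... | inj₂ eq = subst (λ v → next q (iter G k (next q) v) ≡ iter G k (next q) v ⊎ iter G k (next q) v ≡ iter G k (next p) (next p u))
                      (sym eq) (iter-⊑ q⊑p k (next p u))

    -- After N steps the orbit either rests at a root of q or has followed p all the way to w, which
    -- is a root of q as well.
    next-iter : ∀ {q} → q ⊑p → ∀ u → next q (iter G N (next q) u) ≡ iter G N (next q) u
    next-iter {q} q⊑p u with iter-⊑ q⊑p N u
    ... | inj₁ eq = eq
    ... | inj₂ eq = subst (λ v → next q v ≡ v) (sym (trans eq (tree u))) root
      where
      root : next q w ≡ w
      root with q⊑p w
      ... | inj₁ eq = cong (maybe id w) eq
      ... | inj₂ eq = cong (maybe id w) (trans eq pw)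

    iter-lift : ∀ {q} → q ⊑p → ∀ k v → ∃ λ j → iter G j (next p) v ≡ iter G k (next q) v
    iter-lift q⊑p zero    v = 0 , refl
    iter-lift {q} q⊑p (suc k) v with next-⊑ q⊑p v
    ... | inj₁ eq = let j , eq′ = iter-lift q⊑p k v in j , trans eq′ (cong (iter G k (next q)) (sym eq))
    ... | inj₂ eq = let j , eq′ = iter-lift q⊑p k (next p v) in suc j , trans eq′ (cong (iter G k (next q)) (sym eq))

    -- A return from v to u would close a cycle of p through u, of length j + 1. Going round it N
    -- times takes at least N steps and so ends at w; hence u = w, but no arrow leaves w.
    acyclic : ∀ {q u v} → q ⊑p → p u ≡ just v → iter G N (next q) v ≢ u
    acyclic {q} {u} {v} q⊑p pu eq with iter-lift q⊑p N v
    ... | j , eq′ = nothing≢just (trans (sym pw) (trans (cong p (sym u≡w)) pu))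
      where
      nothing≢just : nothing ≢ just v
      nothing≢just ()
      cycle : iter G (suc j) (next p) u ≡ u
      cycle = trans (cong (iter G j (next p)) (cong (maybe id u) pu)) (trans eq′ eq)
      open ≡-Reasoning
      u≡w : u ≡ w
      u≡w = begin
        u                                                     ≡⟨ iter-* N (suc j) (next p) cycle ⟨
        iter G (N ℕ.* suc j) (next p) u                       ≡⟨ cong (λ k → iter G k (next p) u) (ℕₚ.*-suc N j) ⟩
        iter G (N ℕ.+ N ℕ.* j) (next p) u                     ≡⟨ iter-+ N (N ℕ.* j) (next p) u ⟩
        iter G (N ℕ.* j) (next p) (iter G N (next p) u)       ≡⟨ cong (iter G (N ℕ.* j) (next p)) (tree u) ⟩
        iter G (N ℕ.* j) (next p) w                           ≡⟨ iter-fixed (N ℕ.* j) (next p) (cong (maybe id w) pw) ⟩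
        w                                                     ∎

    ≔-⊑ : ∀ {q} u → q ⊑p → (q [ u ≔ nothing ]) ⊑p
    ≔-⊑ u q⊑p v with v ≟ u
    ... | yes _ = inj₁ refl
    ... | no _  = q⊑p v

    -- Deleting the arrow out of u changes the determinant by one that the
    -- indicator of the subtree above u annihilates.
    det-delete : ∀ {q} → q ⊑p → ∀ u → det N (map (arrow q) (allFin N)) ≡ det N (map (arrow (q [ u ≔ nothing ])) (allFin N))
    det-delete {q} q⊑p u with q u in qu
    ... | nothing = cong (det N) (Listₚ.map-cong same (allFin N))
      where
      same : ∀ x → arrow q x ≡ arrow (q [ u ≔ nothing ]) x
      same x with x ≟ u
      ... | yes refl = cong (maybe (λ v → -1ℤ ⊙ 𝐞 v ⊕ 𝐞 u) (𝐞 u)) qu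
      ... | no _     = refl
    ... | just v = begin
      det N (map (arrow q) (allFin N))                                       ≡⟨ cong (det N) (Listₚ.map-cong old (allFin N)) ⟩
      det N (map (arrow q [ u ≔ -1ℤ ⊙ 𝐞 v ⊕ 𝐞 u ]) (allFin N))              ≡⟨ ≔-lin (det-form N) (arrow q) u -1ℤ (𝐞 v) (𝐞 u) ⟩
      -1ℤ * det N (map (arrow q [ u ≔ 𝐞 v ]) (allFin N)) + det N (map (arrow q [ u ≔ 𝐞 u ]) (allFin N))
        ≡⟨ cong₂ (λ s t → -1ℤ * s + t) (det-dot φ kills u φu) (cong (det N) (Listₚ.map-cong new (allFin N))) ⟩
      -1ℤ * 0ℤ + det N (map (arrow q′) (allFin N))                           ≡⟨ ℤₚ.+-identityˡ _ ⟩
      det N (map (arrow q′) (allFin N))                                      ∎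
      where
      open ≡-Reasoning
      q′ = q [ u ≔ nothing ]
      q′⊑p : q′ ⊑p
      q′⊑p = ≔-⊑ u q⊑p
      old : ∀ x → arrow q x ≡ (arrow q [ u ≔ -1ℤ ⊙ 𝐞 v ⊕ 𝐞 u ]) x
      old x with x ≟ u
      ... | yes refl = cong (maybe (λ v → -1ℤ ⊙ 𝐞 v ⊕ 𝐞 u) (𝐞 u)) qu
      ... | no _     = refl
      new : ∀ x → (arrow q [ u ≔ 𝐞 u ]) x ≡ arrow q′ x
      new x with x ≟ u
      ... | yes refl = refl
      ... | no _     = refl
      φ : Fin N → ℤ
      φ x = ind ⌊ iter G N (next q′) x ≟ u ⌋
      pu : p u ≡ just v
      pu with q⊑p u
      ... | inj₁ eq with () ← trans (sym qu) eq
      ... | inj₂ eq = trans (sym eq) qu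
      φu : φ u ≡ 1ℤ
      φu = trans (cong (λ x → ind ⌊ x ≟ u ⌋) (iter-fixed N (next q′) (cong (maybe id u) (≔-same q u nothing)))) (cong ind (≟-refl u))
      φv : φ v ≡ 0ℤ
      φv = cong ind (≟-≢ (acyclic q′⊑p pu))
      φ-next : ∀ x → φ x ≡ φ (next q′ x)
      φ-next x = cong (λ y → ind ⌊ y ≟ u ⌋) (sym (trans (iter-comm N (next q′) x) (next-iter q′⊑p x)))
      kills : ∀ x → dot φ ((arrow q [ u ≔ 𝐞 v ]) x) ≡ 0ℤ
      kills x with x ≟ u
      ... | yes _  = trans (dot-𝐞 φ v) φv
      ... | no x≢u with q x in qx
      ...   | just y  = dot-edge φ (trans (φ-next x) (cong φ (trans (cong (maybe id x) (≔-other q nothing x≢u)) (cong (maybe id x) qx))))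
      ...   | nothing = trans (dot-𝐞 φ x) (cong ind (trans (cong (λ y → ⌊ y ≟ u ⌋)
                          (iter-fixed N (next q′) (trans (cong (maybe id x) (≔-other q nothing x≢u)) (cong (maybe id x) qx)))) (≟-≢ x≢u)))

    -- All arrows are deleted in turn by `det-delete`, which leaves the unit vectors.
    det-tree : det N (map (arrow p) (allFin N)) ≡ 1ℤ
    det-tree = begin
      det N (map (arrow p) (allFin N))                     ≡⟨ all-deleted (allFin N) ⟩
      det N (map (arrow (cut (allFin N))) (allFin N))      ≡⟨ cong (det N) (Listₚ.map-cong (λ u → cong (maybe (λ v → -1ℤ ⊙ 𝐞 v ⊕ 𝐞 u) (𝐞 u)) (cut-∈ (∈-allFin u))) (allFin N)) ⟩
      det N (map 𝐞 (allFin N))                             ≡⟨ det-𝐞 N ⟩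
      1ℤ                                                   ∎
      where
      open ≡-Reasoning
      cut : List (Fin N) → Fin N → Maybe (Fin N)
      cut = foldr (λ u q → q [ u ≔ nothing ]) p
      cut-⊑ : ∀ us → cut us ⊑p
      cut-⊑ []       v = inj₂ refl
      cut-⊑ (u ∷ us) = ≔-⊑ u (cut-⊑ us)
      cut-∈ : ∀ {us v} → v ∈ us → cut us v ≡ nothing
      cut-∈ {u ∷ us} {v} v∈ with v ≟ u
      ... | yes _ = refl
      cut-∈ (here v≡u) | no v≢u = ⊥-elim (v≢u v≡u)
      cut-∈ (there v∈) | no _   = cut-∈ v∈
      all-deleted : ∀ us → det N (map (arrow p) (allFin N)) ≡ det N (map (arrow (cut us)) (allFin N))
      all-deleted []       = refl
      all-deleted (u ∷ us) = trans (all-deleted us) (det-delete (cut-⊑ us) u)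

-- The matrix-tree theorem

∑-++ : {I : Set} (f : I → ℤ) (us vs : List I) → ∑ (us ++ vs) f ≡ ∑ us f + ∑ vs f
∑-++ f []       vs = sym (ℤₚ.+-identityˡ (∑ vs f))
∑-++ f (u ∷ us) vs = trans (cong (λ t → f u + t) (∑-++ f us vs)) (sym (ℤₚ.+-assoc (f u) (∑ us f) (∑ vs f)))

∑-concatMap : {I J : Set} (g : J → List I) (f : I → ℤ) (vs : List J) → ∑ (concatMap g vs) f ≡ ∑ vs (λ v → ∑ (g v) f)
∑-concatMap g f []       = refl
∑-concatMap g f (v ∷ vs) = trans (∑-++ f (g v) (concatMap g vs)) (cong (λ t → ∑ (g v) f + t) (∑-concatMap g f vs))

+-∑ : {I : Set} (f : I → ℕ) (us : List I) → ℤ.+ foldr ℕ._+_ 0 (map f us) ≡ ∑ us (λ u → ℤ.+ f u)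
+-∑ f []       = refl
+-∑ f (u ∷ us) = trans (ℤₚ.pos-+ (f u) _) (cong (λ t → ℤ.+ f u + t) (+-∑ f us))

module _ {m : ℕ} {A : Set} where

  ⨁ : List A → (A → Vec ℤ m) → Vec ℤ m
  ⨁ as f = foldr _⊕_ 0ᵛ (map f as)

  lookup-⨁ : ∀ as f i → lookup (⨁ as f) i ≡ ∑ as (λ a → lookup (f a) i)
  lookup-⨁ []       f i = lookup-0ᵛ i
  lookup-⨁ (a ∷ as) f i = trans (Vecₚ.lookup-zipWith _+_ i (f a) (⨁ as f)) (cong (λ t → lookup (f a) i + t) (lookup-⨁ as f i))

  form-⨁ : ∀ {F} → AltForm F → ∀ as (f : A → Vec ℤ m) b → F (⨁ as f ∷ b) ≡ ∑ as (λ a → F (f a ∷ b))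
  form-⨁ FA []       f b = lin-zero FA [] b
  form-⨁ {F} FA (a ∷ as) f b = trans (lin-+ FA [] (f a) (⨁ as f) b) (cong (λ t → F (f a ∷ b) + t) (form-⨁ FA as f b))

  -- One summand is chosen in every argument. The recursion is that of `allVecs`, so the index set
  -- is the very list of candidates over which `κ` sums.
  expand-choices : ∀ {N} (G : Graph N) as {k} (Y : Fin k → A → Vec ℤ m) {F} → AltForm F →
    F (tabulate (λ u → ⨁ as (Y u))) ≡ ∑ (allVecs G as k) (λ t → F (tabulate (λ u → Y u (lookup t u))))
  expand-choices G as {zero}  Y FA = sym (ℤₚ.+-identityʳ _)
  expand-choices G as {suc k} Y {F} FA = begin
    F (⨁ as (Y zero) ∷ tabulate (λ u → ⨁ as (Y (suc u))))
      ≡⟨ form-⨁ FA as (Y zero) _ ⟩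
    ∑ as (λ a → F (Y zero a ∷ tabulate (λ u → ⨁ as (Y (suc u)))))
      ≡⟨ ∑-cong as (λ a → trans (expand-choices G as (Y ∘ suc) (fix FA (Y zero a)))
                           (sym (∑-map (a ∷_) _ (allVecs G as k)))) ⟩
    ∑ as (λ a → ∑ (map (a ∷_) (allVecs G as k)) (λ t → F (tabulate (λ u → Y u (lookup t u)))))
      ≡⟨ ∑-concatMap (λ a → map (a ∷_) (allVecs G as k)) _ as ⟨
    ∑ (allVecs G as (suc k)) (λ t → F (tabulate (λ u → Y u (lookup t u)))) ∎
    where open ≡-Reasoning

-- Failure comes with a witness: a vertex with an invalid choice supplies a zero column, and a
-- vertex that does not reach the root supplies the z of `det-nontree`.
conjunction : ∀ {k} (b : Fin k → Bool) →
  (foldr _∧_ true (map b (allFin k)) ≡ true × ∀ u → b u ≡ true) ⊎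
  (foldr _∧_ true (map b (allFin k)) ≡ false × ∃ λ u → b u ≡ false)
conjunction {k} b with go (allFin k)
  where
  go : ∀ us → (foldr _∧_ true (map b us) ≡ true × All (λ u → b u ≡ true) us) ⊎
              (foldr _∧_ true (map b us) ≡ false × ∃ λ u → b u ≡ false)
  go []       = inj₁ (refl , [])
  go (u ∷ us) with b u in bu | go us
  ... | false | _                = inj₂ (refl , u , bu)
  ... | true  | inj₁ (eq , all)  = inj₁ (eq , bu ∷ all)
  ... | true  | inj₂ r           = inj₂ r
... | inj₁ (eq , all) = inj₁ (eq , λ u → All.lookup all (∈-allFin u))
... | inj₂ r          = inj₂ r

module _ {N : ℕ} (G : Graph N) where
  open Graph G

  iter-cong : ∀ k {f g : Fin N → Fin N} → (∀ u → f u ≡ g u) → ∀ u → iter G k f u ≡ iter G k g u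
  iter-cong zero    eq u = refl
  iter-cong (suc k) {g = g} eq u = trans (iter-cong k eq _) (cong (iter G k g) (eq u))

  edge : Fin N → Maybe (Fin nE) → Vec ℤ N
  edge u = maybe (λ a → -1ℤ ⊙ 𝐞 (head a) ⊕ 𝐞 u) (𝐞 u)

  valid : Fin N → Fin N → Maybe (Fin nE) → Bool
  valid w u nothing  = ⌊ u ≟ w ⌋
  valid w u (just a) = not ⌊ u ≟ w ⌋ ∧ ⌊ tail a ≟ u ⌋

  -- Column u of Δ is the sum of its terms over all choices, so that det splits
  -- over the candidates t of isTree.
  term : Fin N → Fin N → Maybe (Fin nE) → Vec ℤ N
  term w u a = if valid w u a then edge u a else 0ᵛ

  validAt-valid : ∀ w t u → validAt G w t u ≡ valid w u (lookup t u)
  validAt-valid w t u with lookup t u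
  ... | nothing = refl
  ... | just _  = refl

  pointer : Vec (Maybe (Fin nE)) N → Fin N → Maybe (Fin N)
  pointer t u = Maybe.map head (lookup t u)

  next-pointer : ∀ t u → next G (pointer t) u ≡ parent G t u
  next-pointer t u with lookup t u
  ... | nothing = refl
  ... | just _  = refl

  arrow-pointer : ∀ t u → arrow G (pointer t) u ≡ edge u (lookup t u)
  arrow-pointer t u with lookup t u
  ... | nothing = refl
  ... | just _  = refl

  -- An invalid choice gives a zero column. If all choices are valid, w is the only root of the
  -- pointer map, and `det-tree` or `det-nontree` applies according to whether every vertex reaches
  -- w.
  det-choice : ∀ w t → det N (map (λ u → term w u (lookup t u)) (allFin N)) ≡ ind (isTree G w t)
  det-choice w t with conjunction (λ u → validAt G w t u)
     | conjunction (λ u → validAt G w t u ∧ ⌊ iter G N (parent G t) u ≟ w ⌋)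
  ... | inj₂ (_ , u , inv) | inj₂ (eq , _) = trans
          (zero-entry (det-form N) _ u (cong (λ b → if b then edge u (lookup t u) else 0ᵛ) (trans (sym (validAt-valid w t u)) inv)))
          (cong ind (sym eq))
  ... | inj₂ (_ , u , inv) | inj₁ (_ , all) with () ← trans (sym (all u)) (cong (_∧ ⌊ iter G N (parent G t) u ≟ w ⌋) inv)
  det-choice w t | inj₁ (_ , val) | r = trans (cong (det N) (Listₚ.map-cong all-arrows (allFin N))) (go r)
    where
    val′ : ∀ u → valid w u (lookup t u) ≡ true
    val′ u = trans (sym (validAt-valid w t u)) (val u)
    all-arrows : ∀ u → term w u (lookup t u) ≡ arrow G (pointer t) u
    all-arrows u = trans (cong (λ b → if b then edge u (lookup t u) else 0ᵛ) (val′ u)) (sym (arrow-pointer t u))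
    root : pointer t w ≡ nothing
    root with lookup t w in eq
    ... | nothing = refl
    ... | just a with () ← trans (sym (cong (λ b → not b ∧ ⌊ tail a ≟ w ⌋) (≟-refl w))) (trans (cong (valid w w) (sym eq)) (val′ w))
    nonroot : ∀ u → u ≢ w → pointer t u ≢ nothing
    nonroot u u≢w eq with lookup t u in eq′
    ... | nothing with () ← trans (sym (≟-≢ u≢w)) (trans (cong (valid w u) (sym eq′)) (val′ u))
    iter-pointer : ∀ u → iter G N (next G (pointer t)) u ≡ iter G N (parent G t) u
    iter-pointer = iter-cong N (next-pointer t)
    go : _ → det N (map (arrow G (pointer t)) (allFin N)) ≡ ind (isTree G w t)
    go (inj₁ (eq , all)) = trans (det-tree G {pointer t} root (λ u → trans (iter-pointer u) (reach u))) (cong ind (sym eq))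
      where
      reach : ∀ u → iter G N (parent G t) u ≡ w
      reach u with iter G N (parent G t) u ≟ w | all u
      ... | yes p | _ = p
      ... | no _  | eq′ with () ← trans (sym eq′) (Boolₚ.∧-zeroʳ (validAt G w t u))
    go (inj₂ (eq , z , zf)) = trans (det-nontree G {pointer t} root nonroot z (λ p → unreach (trans (sym (iter-pointer z)) p))) (cong ind (sym eq))
      where
      unreach : iter G N (parent G t) z ≢ w
      unreach p with () ← trans (sym zf) (cong₂ _∧_ (val z) (trans (cong (λ x → ⌊ x ≟ w ⌋) p) (≟-refl w)))

  col : Fin N → Vec ℤ N
  col w = Vec.tabulate (Δ G (δ G w))

  +-outdeg : ∀ v → ℤ.+ outdeg G v ≡ ∑Fin (λ a → ind ⌊ tail a ≟ v ⌋)
  +-outdeg v = +-∑ _ (allFin nE)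

  col-edges : ∀ u i → lookup (col u) i ≡ ∑Fin (λ a → ind ⌊ tail a ≟ u ⌋ * lookup (edge u (just a)) i)
  col-edges u i = begin
    lookup (col u) i
      ≡⟨ Vecₚ.lookup∘tabulate _ i ⟩
    ℤ.+ outdeg G i * ind ⌊ i ≟ u ⌋ - ∑Fin (λ a → ind ⌊ head a ≟ i ⌋ * ind ⌊ tail a ≟ u ⌋)
      ≡⟨ cong (λ t → t - ∑Fin (λ a → ind ⌊ head a ≟ i ⌋ * ind ⌊ tail a ≟ u ⌋))
           (trans (cong (_* ind ⌊ i ≟ u ⌋) (+-outdeg i)) (sym (∑-*ʳ (ind ⌊ i ≟ u ⌋) _ (allFin nE)))) ⟩
    ∑Fin (λ a → ind ⌊ tail a ≟ i ⌋ * ind ⌊ i ≟ u ⌋) - ∑Fin (λ a → ind ⌊ head a ≟ i ⌋ * ind ⌊ tail a ≟ u ⌋)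
      ≡⟨ ∑-minus _ _ (allFin nE) ⟨
    ∑Fin (λ a → ind ⌊ tail a ≟ i ⌋ * ind ⌊ i ≟ u ⌋ - ind ⌊ head a ≟ i ⌋ * ind ⌊ tail a ≟ u ⌋)
      ≡⟨ ∑-cong (allFin nE) (λ a → trans (cong₂ (λ s b → s - ind b * ind ⌊ tail a ≟ u ⌋) (same-tail (tail a)) (≟-sym (head a) i))
           (trans (lem (ind ⌊ tail a ≟ u ⌋) (ind ⌊ i ≟ u ⌋) (ind ⌊ i ≟ head a ⌋)) (cong (ind ⌊ tail a ≟ u ⌋ *_) (sym (edge-at a))))) ⟩
    _ ∎
    where
    open ≡-Reasoning
    same-tail : ∀ v → ind ⌊ v ≟ i ⌋ * ind ⌊ i ≟ u ⌋ ≡ ind ⌊ v ≟ u ⌋ * ind ⌊ i ≟ u ⌋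
    same-tail v with i ≟ u
    ... | yes refl = refl
    ... | no _     = trans (ℤₚ.*-zeroʳ (ind ⌊ v ≟ i ⌋)) (sym (ℤₚ.*-zeroʳ (ind ⌊ v ≟ u ⌋)))
    edge-at : ∀ a → lookup (edge u (just a)) i ≡ -1ℤ * ind ⌊ i ≟ head a ⌋ + ind ⌊ i ≟ u ⌋
    edge-at a = trans (lookup-lin -1ℤ (𝐞 (head a)) (𝐞 u) i) (cong₂ (λ s t → -1ℤ * s + t) (lookup-𝐞 (head a) i) (lookup-𝐞 u i))
    lem : ∀ t s h → t * s - h * t ≡ t * (-1ℤ * h + s)
    lem = solve-∀

  -- At w the choice `nothing` alone is valid and contributes 𝐞 w; at any other u the valid choices
  -- are the edges leaving u, which add up to the column of Δ.
  col-choices : ∀ w u → (col [ w ≔ 𝐞 w ]) u ≡ ⨁ (allChoices G) (term w u)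
  col-choices w u = lookup-ext λ i → sym (trans (lookup-⨁ (allChoices G) (term w u) i) (trans (cong (λ t → lookup (term w u nothing) i + t) (∑-map just (λ a → lookup (term w u a) i) (allFin nE))) (go i)))
    where
    go : ∀ i → lookup (term w u nothing) i + ∑Fin (λ a → lookup (term w u (just a)) i) ≡ lookup ((col [ w ≔ 𝐞 w ]) u) i
    go i with u ≟ w
    ... | yes refl = trans (cong (λ t → lookup (𝐞 w) i + t) (∑-0 (allFin nE) (λ _ → lookup-0ᵛ i))) (ℤₚ.+-identityʳ _)
    ... | no _     = trans (cong₂ _+_ (lookup-0ᵛ i) (∑-cong (allFin nE) selected)) (trans (ℤₚ.+-identityˡ _) (sym (col-edges u i)))
      where
      selected : ∀ a → lookup (if ⌊ tail a ≟ u ⌋ then edge u (just a) else 0ᵛ) i ≡ ind ⌊ tail a ≟ u ⌋ * lookup (edge u (just a)) i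
      selected a with ⌊ tail a ≟ u ⌋
      ... | true  = sym (ℤₚ.*-identityˡ _)
      ... | false = lookup-0ᵛ i

  matrix-tree : ∀ w → det N (map (col [ w ≔ 𝐞 w ]) (allFin N)) ≡ ℤ.+ κ G w
  matrix-tree w = begin
    det N (map (col [ w ≔ 𝐞 w ]) (allFin N))
      ≡⟨ cong (det N) (trans (Listₚ.map-cong (col-choices w) (allFin N)) (Listₚ.map-tabulate id _)) ⟩
    det N (tabulate (λ u → ⨁ (allChoices G) (term w u)))
      ≡⟨ expand-choices G (allChoices G) (term w) (det-form N) ⟩
    ∑ (allVecs G (allChoices G) N) (λ t → det N (tabulate (λ u → term w u (lookup t u))))
      ≡⟨ ∑-cong (allVecs G (allChoices G) N) (λ t → trans (cong (det N) (sym (Listₚ.map-tabulate id _))) (det-choice w t)) ⟩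
    ∑ (allVecs G (allChoices G) N) (λ t → ind (isTree G w t))
      ≡⟨ +-∑ _ (allVecs G (allChoices G) N) ⟨
    ℤ.+ κ G w ∎
    where open ≡-Reasoning

-- The image and the kernel of Δ

-- P describes a subgroup of ℤ, and Bézout's identity writes the gcd as a combination of m and n.
gcd-closed : ∀ {P : ℤ → Set} → (∀ k {x y} → P x → P y → P (k * x + y)) → P 0ℤ →
             ∀ m n → P (ℤ.+ m) → P (ℤ.+ n) → P (ℤ.+ gcd m n)
gcd-closed {P} closed P0 m n Pm Pn = bézout (Bézout.identity (gcd-GCD m n))
  where
  -- The trailing 0ℤ comes from `P0`, which ends the chain of applications of `closed`.
  combination : ∀ d x y m n → d ℕ.+ y ℕ.* n ≡ x ℕ.* m → ℤ.+ x * ℤ.+ m + (- ℤ.+ y * ℤ.+ n + 0ℤ) ≡ ℤ.+ d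
  combination d x y m n eq = begin
    ℤ.+ x * ℤ.+ m + (- ℤ.+ y * ℤ.+ n + 0ℤ)              ≡⟨ cong (_+ (- ℤ.+ y * ℤ.+ n + 0ℤ)) (ℤₚ.pos-* x m) ⟨
    ℤ.+ (x ℕ.* m) + (- ℤ.+ y * ℤ.+ n + 0ℤ)              ≡⟨ cong (λ t → ℤ.+ t + (- ℤ.+ y * ℤ.+ n + 0ℤ)) eq ⟨
    ℤ.+ (d ℕ.+ y ℕ.* n) + (- ℤ.+ y * ℤ.+ n + 0ℤ)        ≡⟨ cong (_+ (- ℤ.+ y * ℤ.+ n + 0ℤ)) (trans (ℤₚ.pos-+ d _) (cong (ℤ.+ d +_) (ℤₚ.pos-* y n))) ⟩
    (ℤ.+ d + ℤ.+ y * ℤ.+ n) + (- ℤ.+ y * ℤ.+ n + 0ℤ)    ≡⟨ lem (ℤ.+ d) (ℤ.+ y) (ℤ.+ n) ⟩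
    ℤ.+ d                                               ∎
    where
    open ≡-Reasoning
    lem : ∀ d y n → (d + y * n) + (- y * n + 0ℤ) ≡ d
    lem = solve-∀
  bézout : Bézout.Identity (gcd m n) m n → P (ℤ.+ gcd m n)
  bézout (Bézout.+- x y eq) = subst P (combination (gcd m n) x y m n eq) (closed (ℤ.+ x) Pm (closed (- ℤ.+ y) Pn P0))
  bézout (Bézout.-+ x y eq) = subst P (combination (gcd m n) y x n m eq) (closed (ℤ.+ y) Pn (closed (- ℤ.+ x) Pm P0))

foldr-gcd-closed : ∀ {P : ℤ → Set} → (∀ k {x y} → P x → P y → P (k * x + y)) → P 0ℤ →
                   ∀ {ms} → All (λ m → P (ℤ.+ m)) ms → P (ℤ.+ foldr gcd 0 ms)
foldr-gcd-closed closed P0 []         = P0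
foldr-gcd-closed {P} closed P0 (Pm ∷ Pms) = gcd-closed {P} closed P0 _ _ Pm (foldr-gcd-closed {P} closed P0 Pms)

foldr-gcd-∣ : ∀ {m ms} → m ∈ ms → foldr gcd 0 ms ℕ∣.∣ m
foldr-gcd-∣ (here refl)          = gcd[m,n]∣m _ _
foldr-gcd-∣ {ms = m ∷ _} (there m∈) = ℕ∣.∣-trans (gcd[m,n]∣n m _) (foldr-gcd-∣ m∈)

⊆-omit : {I : Set} {S us : List I} → S ⊆ us → length us ≡ suc (length S) →
         ∃ λ a → ∃ λ w → ∃ λ b → us ≡ a ++ w ∷ b × S ≡ a ++ b
⊆-omit {S = S} (w ∷ʳ S⊆) len = [] , w , _ , refl , full S⊆ (sym (ℕₚ.suc-injective len))
  where
  full : ∀ {S us} → S ⊆ us → length S ≡ length us → S ≡ us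
  full []          len = refl
  full (y ∷ʳ S⊆)   len = ⊥-elim (ℕₚ.<-irrefl refl (subst (ℕ._≤ _) len (Subₚ.length-mono-≤ S⊆)))
  full (refl ∷ S⊆) len = cong (_ ∷_) (full S⊆ (ℕₚ.suc-injective len))
⊆-omit (_∷_ {x} refl S⊆) len with ⊆-omit S⊆ (ℕₚ.suc-injective len)
... | a , w , b , eq , eq′ = x ∷ a , w , b , cong (x ∷_) eq , cong (x ∷_) eq′

module _ {m : ℕ} where

  total : Vec ℤ m → ℤ
  total = dot (λ _ → 1ℤ)

  total-∑ : ∀ x → total x ≡ ∑Fin (lookup x)
  total-∑ x = ∑-cong (allFin m) (λ v → ℤₚ.*-identityˡ (lookup x v))

module _ {N : ℕ} (G : Graph N) where
  open Graph G

  Δ-col : ∀ f v → Δ G f v ≡ ∑Fin (λ w → f w * lookup (col G w) v)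
  Δ-col f v = sym (begin
    ∑Fin (λ w → f w * lookup (col G w) v)
      ≡⟨ ∑-cong (allFin N) (λ w → trans (cong (f w *_) (Vecₚ.lookup∘tabulate _ v)) (lem (f w) (ℤ.+ outdeg G v) (ind ⌊ v ≟ w ⌋) _)) ⟩
    ∑Fin (λ w → ℤ.+ outdeg G v * f w * ind ⌊ v ≟ w ⌋ - f w * ∑Fin (λ a → ind ⌊ head a ≟ v ⌋ * ind ⌊ tail a ≟ w ⌋))
      ≡⟨ ∑-minus _ _ (allFin N) ⟩
    ∑Fin (λ w → ℤ.+ outdeg G v * f w * ind ⌊ v ≟ w ⌋) - ∑Fin (λ w → f w * ∑Fin (λ a → ind ⌊ head a ≟ v ⌋ * ind ⌊ tail a ≟ w ⌋))
      ≡⟨ cong₂ _-_ (∑-δ′ (λ w → ℤ.+ outdeg G v * f w) v) incoming ⟩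
    Δ G f v ∎)
    where
    open ≡-Reasoning
    lem : ∀ f d i s → f * (d * i - s) ≡ d * f * i - f * s
    lem = solve-∀
    lem′ : ∀ f h t → f * (h * t) ≡ h * f * t
    lem′ = solve-∀
    incoming : ∑Fin (λ w → f w * ∑Fin (λ a → ind ⌊ head a ≟ v ⌋ * ind ⌊ tail a ≟ w ⌋)) ≡ ∑Fin (λ a → ind ⌊ head a ≟ v ⌋ * f (tail a))
    incoming = begin
      ∑Fin (λ w → f w * ∑Fin (λ a → ind ⌊ head a ≟ v ⌋ * ind ⌊ tail a ≟ w ⌋))
        ≡⟨ ∑-cong (allFin N) (λ w → trans (sym (∑-*ˡ (f w) _ (allFin nE))) (∑-cong (allFin nE) (λ a → lem′ (f w) (ind ⌊ head a ≟ v ⌋) _))) ⟩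
      ∑Fin (λ w → ∑Fin (λ a → ind ⌊ head a ≟ v ⌋ * f w * ind ⌊ tail a ≟ w ⌋))
        ≡⟨ ∑-swap _ (allFin N) (allFin nE) ⟩
      ∑Fin (λ a → ∑Fin (λ w → ind ⌊ head a ≟ v ⌋ * f w * ind ⌊ tail a ≟ w ⌋))
        ≡⟨ ∑-cong (allFin nE) (λ a → ∑-δ′ (λ w → ind ⌊ head a ≟ v ⌋ * f w) (tail a)) ⟩
      ∑Fin (λ a → ind ⌊ head a ≟ v ⌋ * f (tail a)) ∎

  Δ-cong : ∀ {f g} → (∀ w → f w ≡ g w) → ∀ v → Δ G f v ≡ Δ G g v
  Δ-cong eq v = trans (Δ-col _ v) (trans (∑-cong (allFin N) (λ w → cong (_* lookup (col G w) v) (eq w))) (sym (Δ-col _ v)))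

  Δ-lin : ∀ k f g v → Δ G (λ w → k * f w + g w) v ≡ k * Δ G f v + Δ G g v
  Δ-lin k f g v = begin
    Δ G (λ w → k * f w + g w) v                             ≡⟨ Δ-col _ v ⟩
    ∑Fin (λ w → (k * f w + g w) * lookup (col G w) v)       ≡⟨ ∑-cong (allFin N) (λ w → lem k (f w) (g w) _) ⟩
    ∑Fin (λ w → k * (f w * lookup (col G w) v) + g w * lookup (col G w) v)
                                                            ≡⟨ ∑-+ _ _ (allFin N) ⟩
    ∑Fin (λ w → k * (f w * lookup (col G w) v)) + ∑Fin (λ w → g w * lookup (col G w) v)
                                                            ≡⟨ cong₂ _+_ (trans (∑-*ˡ k _ (allFin N)) (cong (k *_) (sym (Δ-col f v)))) (sym (Δ-col g v)) ⟩
    k * Δ G f v + Δ G g v                                   ∎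
    where
    open ≡-Reasoning
    lem : ∀ k f g c → (k * f + g) * c ≡ k * (f * c) + g * c
    lem = solve-∀

  Δ-zero : ∀ v → Δ G (λ _ → 0ℤ) v ≡ 0ℤ
  Δ-zero v = trans (Δ-col (λ _ → 0ℤ) v) (∑-0 (allFin N) (λ w → ℤₚ.*-zeroˡ (lookup (col G w) v)))

  -- Every edge a contributes `f (tail a)` once at its tail and once, with the opposite sign, at its
  -- head.
  ∑-Δ : ∀ f → ∑Fin (Δ G f) ≡ 0ℤ
  ∑-Δ f = begin
    ∑Fin (Δ G f)                                            ≡⟨ ∑-minus _ _ (allFin N) ⟩
    ∑Fin (λ v → ℤ.+ outdeg G v * f v) - ∑Fin (λ v → ∑Fin (λ a → ind ⌊ head a ≟ v ⌋ * f (tail a)))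
      ≡⟨ cong₂ _-_ out in′ ⟩
    ∑Fin (λ a → f (tail a)) - ∑Fin (λ a → f (tail a))       ≡⟨ ℤₚ.+-inverseʳ (∑Fin (λ a → f (tail a))) ⟩
    0ℤ                                                      ∎
    where
    open ≡-Reasoning
    out : ∑Fin (λ v → ℤ.+ outdeg G v * f v) ≡ ∑Fin (λ a → f (tail a))
    out = begin
      ∑Fin (λ v → ℤ.+ outdeg G v * f v)
        ≡⟨ ∑-cong (allFin N) (λ v → trans (cong (_* f v) (+-outdeg G v)) (trans (sym (∑-*ʳ (f v) _ (allFin nE)))
             (∑-cong (allFin nE) (λ a → ℤₚ.*-comm (ind ⌊ tail a ≟ v ⌋) (f v))))) ⟩
      ∑Fin (λ v → ∑Fin (λ a → f v * ind ⌊ tail a ≟ v ⌋))    ≡⟨ ∑-swap _ (allFin N) (allFin nE) ⟩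
      ∑Fin (λ a → ∑Fin (λ v → f v * ind ⌊ tail a ≟ v ⌋))    ≡⟨ ∑-cong (allFin nE) (λ a → ∑-δ′ f (tail a)) ⟩
      ∑Fin (λ a → f (tail a))                               ∎
    in′ : ∑Fin (λ v → ∑Fin (λ a → ind ⌊ head a ≟ v ⌋ * f (tail a))) ≡ ∑Fin (λ a → f (tail a))
    in′ = trans (∑-swap _ (allFin N) (allFin nE)) (∑-cong (allFin nE) (λ a →
      trans (∑-cong (allFin N) (λ v → ℤₚ.*-comm (ind ⌊ head a ≟ v ⌋) (f (tail a)))) (∑-δ′ (λ _ → f (tail a)) (head a))))

  total-col : ∀ w → total (col G w) ≡ 0ℤ
  total-col w = trans (total-∑ (col G w)) (trans (∑-cong (allFin N) (Vecₚ.lookup∘tabulate _)) (∑-Δ (δ G w)))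

  -- The cofactors belonging to column w do not depend on the row s: with 𝐞 w - 𝐞 s in place w all
  -- columns have total 0, so the two determinants agree.
  det-col-𝐞 : ∀ w s → det N (map (col G [ w ≔ 𝐞 s ]) (allFin N)) ≡ ℤ.+ κ G w
  det-col-𝐞 w s = begin
    det N (map (col G [ w ≔ 𝐞 s ]) (allFin N))
      ≡⟨ lem _ _ ⟩
    - (-1ℤ * det N (map (col G [ w ≔ 𝐞 s ]) (allFin N)) + det N (map (col G [ w ≔ 𝐞 w ]) (allFin N))) + det N (map (col G [ w ≔ 𝐞 w ]) (allFin N))
      ≡⟨ cong₂ (λ s t → - s + t) (trans (sym (≔-lin (det-form N) (col G) w -1ℤ (𝐞 s) (𝐞 w))) (det-dot (λ _ → 1ℤ) kills w refl)) (matrix-tree G w) ⟩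
    - 0ℤ + ℤ.+ κ G w
      ≡⟨ ℤₚ.+-identityˡ _ ⟩
    ℤ.+ κ G w ∎
    where
    open ≡-Reasoning
    lem : ∀ s t → s ≡ - (-1ℤ * s + t) + t
    lem = solve-∀
    kills : ∀ u → total ((col G [ w ≔ -1ℤ ⊙ 𝐞 s ⊕ 𝐞 w ]) u) ≡ 0ℤ
    kills u with u ≟ w
    ... | yes _ = dot-edge (λ _ → 1ℤ) {w} {s} refl
    ... | no _  = total-col u

  -- By `det-col-𝐞` the numbers κ w are the cofactors of row v, so coordinate v of Δκ is the
  -- expansion of det Δ along that row; and det Δ = 0, since all columns have total 0.
  Δ-κ : ∀ v → Δ G (λ w → ℤ.+ κ G w) v ≡ 0ℤ
  Δ-κ v = begin
    Δ G (λ w → ℤ.+ κ G w) v                                       ≡⟨ Δ-col (λ w → ℤ.+ κ G w) v ⟩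
    ∑Fin (λ w → ℤ.+ κ G w * lookup (col G w) v)
      ≡⟨ ∑-cong (allFin N) (λ w → trans (ℤₚ.*-comm (ℤ.+ κ G w) _) (cong (lookup (col G w) v *_) (sym (det-col-𝐞 w v)))) ⟩
    ∑Fin (λ w → lookup (col G w) v * det N (map (col G [ w ≔ 𝐞 v ]) (allFin N)))
      ≡⟨ cramer (lookup-linear v) (col G) (𝐞 v) ⟨
    lookup (𝐞 v) v * det N (map (col G) (allFin N))               ≡⟨ cong (lookup (𝐞 v) v *_) (det-dot (λ _ → 1ℤ) total-col v refl) ⟩
    lookup (𝐞 v) v * 0ℤ                                           ≡⟨ ℤₚ.*-zeroʳ (lookup (𝐞 v) v) ⟩
    0ℤ                                                            ∎
    where open ≡-Reasoning

  InImage : (Fin N → ℤ) → Set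
  InImage σ = ∃ λ f → ∀ v → Δ G f v ≡ σ v

  -- Cramer's rule for the columns of Δ with 𝐞 w in place w, whose determinant is κ w. The
  -- coefficient of 𝐞 w is 0, because putting σ in its place leaves only columns of total 0; so the
  -- solution combines columns of Δ alone.
  κ-image : ∀ w σ → ∣_∣ G σ ≡ 0ℤ → InImage (λ v → ℤ.+ κ G w * σ v)
  κ-image w σ ∣σ∣≡0 = f , λ v → begin
    Δ G f v                                       ≡⟨ Δ-col f v ⟩
    ∑Fin (λ u → f u * lookup (col G u) v)         ≡⟨ ∑-cong (allFin N) (same v) ⟩
    ∑Fin (λ u → lookup (c u) v * f u)             ≡⟨ cramer (lookup-linear v) c x ⟨
    lookup x v * det N (map c (allFin N))         ≡⟨ cong₂ _*_ (Vecₚ.lookup∘tabulate σ v) (matrix-tree G w) ⟩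
    σ v * ℤ.+ κ G w                               ≡⟨ ℤₚ.*-comm (σ v) _ ⟩
    ℤ.+ κ G w * σ v                               ∎
    where
    open ≡-Reasoning
    x = Vec.tabulate σ
    c = col G [ w ≔ 𝐞 w ]
    f : Fin N → ℤ
    f u = det N (map (c [ u ≔ x ]) (allFin N))
    fw : f w ≡ 0ℤ
    fw = det-dot (λ _ → 1ℤ) kills w refl
      where
      kills : ∀ u → total ((c [ w ≔ x ]) u) ≡ 0ℤ
      kills u with u ≟ w
      ... | yes _ = trans (total-∑ x) (trans (∑-cong (allFin N) (Vecₚ.lookup∘tabulate σ)) ∣σ∣≡0)
      ... | no _  = total-col u
    same : ∀ v u → f u * lookup (col G u) v ≡ lookup (c u) v * f u
    same v u with u ≟ w
    ... | yes refl = trans (cong (_* lookup (col G w) v) fw) (sym (trans (cong (lookup (𝐞 w) v *_) fw) (ℤₚ.*-zeroʳ (lookup (𝐞 w) v))))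
    ... | no _     = ℤₚ.*-comm (f u) (lookup (col G u) v)

module _ {n : ℕ} (G : Graph (suc n)) where

  surjective⇒cond1 : (∀ σ → ∣_∣ G σ ≡ 0ℤ → InImage G σ) → Cond1 G
  surjective⇒cond1 onto σ = mk⇔ (onto σ) (λ { (f , Δf) → trans (∑-cong (allFin (suc n)) (sym ∘ Δf)) (∑-Δ G f) })

  -- For fixed σ of total 0 the integers k with kσ in the image of Δ form a subgroup. It contains
  -- every κ w, hence their gcd.
  cond2⇒cond1 : Cond2 G → Cond1 G
  cond2⇒cond1 M≡1 = surjective⇒cond1 λ σ ∣σ∣≡0 →
    let f , Δf = subst (λ m → P σ (ℤ.+ m)) M≡1 (P-gcd σ ∣σ∣≡0) in
    f , λ v → trans (Δf v) (ℤₚ.*-identityˡ (σ v))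
    where
    P : (Fin (suc n) → ℤ) → ℤ → Set
    P σ k = InImage G (λ v → k * σ v)
    closed : ∀ σ k {x y} → P σ x → P σ y → P σ (k * x + y)
    closed σ k {x} {y} (f , Δf) (g , Δg) = (λ w → k * f w + g w) , λ v →
      trans (Δ-lin G k f g v) (trans (cong₂ (λ s t → k * s + t) (Δf v) (Δg v)) (lem k x y (σ v)))
      where
      lem : ∀ k x y s → k * (x * s) + y * s ≡ (k * x + y) * s
      lem = solve-∀
    P-gcd : ∀ σ → ∣_∣ G σ ≡ 0ℤ → P σ (ℤ.+ M G)
    P-gcd σ ∣σ∣≡0 = foldr-gcd-closed {P σ} (closed σ) ((λ _ → 0ℤ) , Δ-zero G)
      (Allₚ.map⁺ {f = κ G} (All.universal (λ w → κ-image G w σ ∣σ∣≡0) (allFin (suc n))))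

  cond1⇒cond2 : Cond1 G → Cond2 G
  cond1⇒cond2 surj = ℕ∣.∣1⇒≡1 (∣⇒∣ᵤ (subst (q ∣_) value (vanish q (col G) (allFin (suc n)) (fix (det-form (suc n)) (𝐞 zero)) xs
      (Allₚ.map⁺ (All.universal spanned (allFin n))) minors)))
    where
    q = ℤ.+ M G
    -- The differences of the unit vector at `suc v` and the one at `zero`; each has total 0.
    xs : List (Vec ℤ (suc n))
    xs = map (λ v → -1ℤ ∷ 𝐞 v) (allFin n)
    length-xs : length xs ≡ n
    length-xs = trans (Listₚ.length-map _ (allFin n)) (length-allFin n)
    value : det (suc n) (𝐞 zero ∷ xs) ≡ 1ℤ
    value = begin
      det (suc n) (𝐞 zero ∷ xs)            ≡⟨ cong (λ z → det (suc n) (z ∷ xs)) 𝐞-zero ⟩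
      det (suc n) ((1ℤ ∷ 0ᵛ) ∷ xs)         ≡⟨ det-first n xs ⟩
      det n (map Vec.tail xs)              ≡⟨ cong (det n) (Listₚ.map-∘ (allFin n)) ⟨
      det n (map 𝐞 (allFin n))             ≡⟨ det-𝐞 n ⟩
      1ℤ                                   ∎
      where open ≡-Reasoning
    spanned : ∀ v → Span (col G) (allFin (suc n)) (-1ℤ ∷ 𝐞 v)
    spanned v with Equivalence.to (surj (lookup (-1ℤ ∷ 𝐞 v))) ∣x∣≡0
      where
      ∣x∣≡0 : ∑Fin (lookup (-1ℤ ∷ 𝐞 v)) ≡ 0ℤ
      ∣x∣≡0 = trans (∑-suc (lookup (-1ℤ ∷ 𝐞 v))) (cong (-1ℤ +_) (trans (sym (total-∑ (𝐞 v))) (dot-𝐞 (λ _ → 1ℤ) v)))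
    ... | f , Δf = f , lookup-ext λ i → trans (sym (Δf i)) (trans (Δ-col G f i) (sym (lookup-lc (col G) f (allFin (suc n)) i)))
    minors : ∀ S → S ⊆ allFin (suc n) → length S ≡ length xs → q ∣ det (suc n) (𝐞 zero ∷ map (col G) S)
    -- S has n of the n + 1 indices, so it omits a single w. Moving 𝐞 zero into the slot of w costs
    -- a sign and gives a cofactor of column w.
    minors S S⊆ len with ⊆-omit S⊆ (trans (length-allFin (suc n)) (cong suc (sym (trans len length-xs))))
    ... | a , w , b , eq , refl = subst (q ∣_) (sym minor) (∣n⇒∣m*n (sgn (map (col G) a)) (∣ᵤ⇒∣ (foldr-gcd-∣ (∈-map⁺ (κ G) (∈-allFin w)))))
      where
      open ≡-Reasoning
      minor : det (suc n) (𝐞 zero ∷ map (col G) (a ++ b)) ≡ sgn (map (col G) a) * ℤ.+ κ G w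
      minor = begin
        det (suc n) (𝐞 zero ∷ map (col G) (a ++ b))
          ≡⟨ cong (λ l → det (suc n) (𝐞 zero ∷ l)) (Listₚ.map-++ (col G) a b) ⟩
        det (suc n) (𝐞 zero ∷ map (col G) a ++ map (col G) b)
          ≡⟨ from-front (det-form (suc n)) (map (col G) a) (𝐞 zero) (map (col G) b) ⟩
        sgn (map (col G) a) * det (suc n) (map (col G) a ++ 𝐞 zero ∷ map (col G) b)
          ≡⟨ cong (λ l → sgn (map (col G) a) * det (suc n) l) replaced ⟨
        sgn (map (col G) a) * det (suc n) (map (col G [ w ≔ 𝐞 zero ]) (allFin (suc n)))
          ≡⟨ cong (sgn (map (col G) a) *_) (det-col-𝐞 G w zero) ⟩
        sgn (map (col G) a) * ℤ.+ κ G w ∎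
        where
        replaced : map (col G [ w ≔ 𝐞 zero ]) (allFin (suc n)) ≡ map (col G) a ++ 𝐞 zero ∷ map (col G) b
        replaced = let w≢a , w≢b = unique-++⁻ a (subst Unique eq (allFin⁺ (suc n))) in
          trans (cong (map (col G [ w ≔ 𝐞 zero ])) eq) (map-≔ (det-form (suc n)) (col G) (𝐞 zero) w≢a w≢b)

-- Stabilization

0≤∑ : {I : Set} {f : I → ℤ} → (∀ u → 0ℤ ℤ.≤ f u) → ∀ us → 0ℤ ℤ.≤ ∑ us f
0≤∑ 0≤f []       = ℤₚ.≤-refl
0≤∑ 0≤f (u ∷ us) = ℤₚ.+-mono-≤ (0≤f u) (0≤∑ 0≤f us)

∈⇒≤∑ : {I : Set} {f : I → ℤ} → (∀ u → 0ℤ ℤ.≤ f u) → ∀ {u us} → u ∈ us → f u ℤ.≤ ∑ us f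
∈⇒≤∑ {f = f} 0≤f {u} {_ ∷ us} (here refl) = subst (ℤ._≤ f u + ∑ us f) (ℤₚ.+-identityʳ (f u)) (ℤₚ.+-monoʳ-≤ (f u) (0≤∑ 0≤f us))
∈⇒≤∑ {f = f} 0≤f {u} {v ∷ us} (there u∈)  = subst (ℤ._≤ f v + ∑ us f) (ℤₚ.+-identityˡ (f u)) (ℤₚ.+-mono-≤ (0≤f v) (∈⇒≤∑ 0≤f u∈))

0≤ind* : ∀ b k → 0ℤ ℤ.≤ ind b * ℤ.+ k
0≤ind* true  k = subst (0ℤ ℤ.≤_) (sym (ℤₚ.*-identityˡ (ℤ.+ k))) (ℤ.+≤+ ℕ.z≤n)
0≤ind* false k = ℤₚ.≤-refl

∑≡0⇒≡0 : ∀ {k} {f : Fin k → ℤ} → (∀ u → 0ℤ ℤ.≤ f u) → ∑Fin f ≡ 0ℤ → ∀ u → f u ≡ 0ℤ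
∑≡0⇒≡0 0≤f ∑≡0 u = ℤₚ.≤-antisym (subst (_ ℤ.≤_) ∑≡0 (∈⇒≤∑ 0≤f (∈-allFin u))) (0≤f u)

-- For k ≥ 1 the number splits into the nonnegative parts (k - 1)K, K - |x| and |x| + x.
0≤K*k+x : ∀ {K x} k → k ≢ 0 → ℤ.+ ℤ.∣ x ∣ ℤ.≤ K → 0ℤ ℤ.≤ K * ℤ.+ k + x
0≤K*k+x zero    k≢0 ∣x∣≤K = ⊥-elim (k≢0 refl)
0≤K*k+x {K} {x} (suc k) _ ∣x∣≤K = subst (0ℤ ℤ.≤_) (lem K (ℤ.+ k) (ℤ.+ ℤ.∣ x ∣) x)
  (ℤₚ.+-mono-≤ 0≤k*K (ℤₚ.+-mono-≤ (ℤₚ.i≤j⇒0≤j-i ∣x∣≤K) (0≤∣x∣+x x)))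
  where
  lem : ∀ K k a x → k * K + ((K - a) + (a + x)) ≡ K * (1ℤ + k) + x
  lem = solve-∀
  0≤k*K : 0ℤ ℤ.≤ ℤ.+ k * K
  0≤k*K = subst (ℤ._≤ ℤ.+ k * K) (ℤₚ.*-zeroʳ (ℤ.+ k)) (ℤₚ.*-monoˡ-≤-nonNeg (ℤ.+ k) (ℤₚ.≤-trans (ℤ.+≤+ ℕ.z≤n) ∣x∣≤K))
  0≤∣x∣+x : ∀ x → 0ℤ ℤ.≤ ℤ.+ ℤ.∣ x ∣ + x
  0≤∣x∣+x (ℤ.+ n)    = ℤ.+≤+ ℕ.z≤n
  0≤∣x∣+x ℤ.-[1+ n ] = ℤₚ.≤-reflexive (sym (ℤₚ.+-inverseʳ (ℤ.+ suc n)))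

module _ {N : ℕ} (G : Graph N) where
  open Graph G

  -- By Δκ = 0 at `head a`, the sum of κ over the tails of the incoming edges is 0. Its terms are
  -- nonnegative, so each of them is 0.
  κ≡0-backward : ∀ a → κ G (head a) ≡ 0 → κ G (tail a) ≡ 0
  κ≡0-backward a κ≡0 = ℤₚ.+-injective (begin
    ℤ.+ κ G (tail a)                                ≡⟨ ℤₚ.*-identityˡ _ ⟨
    1ℤ * ℤ.+ κ G (tail a)                           ≡⟨ cong (λ b → ind b * ℤ.+ κ G (tail a)) (≟-refl (head a)) ⟨
    inflow a                                        ≡⟨ ∑≡0⇒≡0 (λ b → 0≤ind* ⌊ head b ≟ head a ⌋ (κ G (tail b))) ∑≡0 a ⟩
    0ℤ                                              ∎)
    where
    open ≡-Reasoning
    inflow : Fin nE → ℤ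
    inflow b = ind ⌊ head b ≟ head a ⌋ * ℤ.+ κ G (tail b)
    lem : ∀ s t → s ≡ s * 0ℤ + s
    lem = solve-∀
    ∑≡0 : ∑Fin inflow ≡ 0ℤ
    ∑≡0 = begin
      ∑Fin inflow                                                   ≡⟨ ℤₚ.+-identityˡ _ ⟨
      0ℤ + ∑Fin inflow                                              ≡⟨ cong (_+ ∑Fin inflow) (Δ-κ G (head a)) ⟨
      (ℤ.+ outdeg G (head a) * ℤ.+ κ G (head a) - ∑Fin inflow) + ∑Fin inflow
        ≡⟨ cong (λ k → (ℤ.+ outdeg G (head a) * ℤ.+ k - ∑Fin inflow) + ∑Fin inflow) κ≡0 ⟩
      (ℤ.+ outdeg G (head a) * 0ℤ - ∑Fin inflow) + ∑Fin inflow      ≡⟨ lem′ (ℤ.+ outdeg G (head a)) (∑Fin inflow) ⟩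
      0ℤ                                                            ∎
      where
      lem′ : ∀ d s → (d * 0ℤ - s) + s ≡ 0ℤ
      lem′ = solve-∀

  κ≡0-path : ∀ {v w} → Path G v w → κ G w ≡ 0 → κ G v ≡ 0
  κ≡0-path here       κ≡0 = κ≡0
  κ≡0-path (step a p) κ≡0 = κ≡0-backward a (κ≡0-path p κ≡0)

  -- A single zero of κ would spread backwards along paths to all vertices, and then the gcd would
  -- be 0.
  κ≢0 : StronglyConnected G → M G ≡ 1 → ∀ v → κ G v ≢ 0
  κ≢0 sc M≡1 v κ≡0 = ℕₚ.1+n≢0 (trans (sym M≡1) (all-zero (allFin N)))
    where
    all-zero : ∀ us → foldr gcd 0 (map (κ G) us) ≡ 0
    all-zero []       = refl
    all-zero (u ∷ us) = cong₂ gcd (κ≡0-path (sc u v) κ≡0) (all-zero us)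

  Δ-fire : ∀ v f u → Δ G (λ w → 1ℤ * δ G v w + f w) u ≡ Δ G (δ G v) u + Δ G f u
  Δ-fire v f u = trans (Δ-lin G 1ℤ (δ G v) f u) (cong (_+ Δ G f u) (ℤₚ.*-identityˡ (Δ G (δ G v) u)))

  idle⇒inactive : ∀ (f : Fin N → ℕ) {x} v → f v ≡ 0 → x - Δ G (λ w → ℤ.+ f w) v ℤ.< ℤ.+ outdeg G v → x ℤ.< ℤ.+ outdeg G v
  idle⇒inactive f {x} v fv = ℤₚ.≤-<-trans (subst (ℤ._≤ x - Δ G (λ w → ℤ.+ f w) v) (ℤₚ.+-identityʳ x) (ℤₚ.+-monoʳ-≤ x gain))
    where
    open ≡-Reasoning
    inflow : Fin nE → ℤ
    inflow a = ind ⌊ head a ≟ v ⌋ * ℤ.+ f (tail a)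
    lem : ∀ d s → s ≡ - (d * 0ℤ - s)
    lem = solve-∀
    gain : 0ℤ ℤ.≤ - Δ G (λ w → ℤ.+ f w) v
    gain = subst (0ℤ ℤ.≤_) (begin
      ∑Fin inflow                                        ≡⟨ lem (ℤ.+ outdeg G v) (∑Fin inflow) ⟩
      - (ℤ.+ outdeg G v * 0ℤ - ∑Fin inflow)              ≡⟨ cong (λ k → - (ℤ.+ outdeg G v * ℤ.+ k - ∑Fin inflow)) fv ⟨
      - Δ G (λ w → ℤ.+ f w) v                            ∎)
      (0≤∑ (λ a → 0≤ind* ⌊ head a ≟ v ⌋ (f (tail a))) (allFin nE))

  module _ (f : Fin N → ℕ) (v : Fin N) {m : ℕ} (fv : f v ≡ suc m) where
    open ≡-Reasoning

    once-less : ∀ w → ℤ.+ f w ≡ 1ℤ * δ G v w + ℤ.+ (f [ v ≔ m ]) w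
    once-less w with w ≟ v
    ... | yes refl = cong ℤ.+_ fv
    ... | no _     = sym (ℤₚ.+-identityˡ _)

    ∑-once-less : ∑Fin (λ w → ℤ.+ f w) ≡ 1ℤ + ∑Fin (λ w → ℤ.+ (f [ v ≔ m ]) w)
    ∑-once-less = begin
      ∑Fin (λ w → ℤ.+ f w)                                       ≡⟨ ∑-cong (allFin N) once-less ⟩
      ∑Fin (λ w → 1ℤ * δ G v w + ℤ.+ (f [ v ≔ m ]) w)            ≡⟨ ∑-+ (λ w → 1ℤ * δ G v w) (λ w → ℤ.+ (f [ v ≔ m ]) w) (allFin N) ⟩
      ∑Fin (λ w → 1ℤ * δ G v w) + ∑Fin (λ w → ℤ.+ (f [ v ≔ m ]) w) ≡⟨ cong (_+ ∑Fin (λ w → ℤ.+ (f [ v ≔ m ]) w)) (∑-δ (λ _ → 1ℤ) v) ⟩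
      1ℤ + ∑Fin (λ w → ℤ.+ (f [ v ≔ m ]) w)                      ∎

    Δ-once-less : ∀ σ u → σ u - Δ G (λ w → ℤ.+ f w) u ≡ fire G v σ u - Δ G (λ w → ℤ.+ (f [ v ≔ m ]) w) u
    Δ-once-less σ u = begin
      σ u - Δ G (λ w → ℤ.+ f w) u                                         ≡⟨ cong (λ t → σ u - t) (trans (Δ-cong G once-less u) (Δ-fire v (λ w → ℤ.+ (f [ v ≔ m ]) w) u)) ⟩
      σ u - (Δ G (δ G v) u + Δ G (λ w → ℤ.+ (f [ v ≔ m ]) w) u)           ≡⟨ lem (σ u) (Δ G (δ G v) u) (Δ G (λ w → ℤ.+ (f [ v ≔ m ]) w) u) ⟩
      fire G v σ u - Δ G (λ w → ℤ.+ (f [ v ≔ m ]) w) u                    ∎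
      where
      lem : ∀ s a b → s - (a + b) ≡ (s - a) - b
      lem = solve-∀

  stable-or-active : ∀ σ → Stable G σ ⊎ ∃ (Active G σ)
  stable-or-active σ with Finₚ.all? (λ v → σ v ℤ.<? ℤ.+ outdeg G v)
  ... | yes all = inj₁ all
  ... | no ¬all = let v , ¬σv< = Finₚ.¬∀⟶∃¬ N _ (λ v → σ v ℤ.<? ℤ.+ outdeg G v) ¬all in inj₂ (v , ℤₚ.≮⇒≥ ¬σv<)

  -- A vertex v with f v = 0 only receives chips when f is fired, so as long as
  -- σ − Δ f is stable, an active vertex has f v > 0 and may be fired.
  stabilize : ∀ k (f : Fin N → ℕ) σ → ∑Fin (λ v → ℤ.+ f v) ≡ ℤ.+ k →
              (∀ v → σ v - Δ G (λ w → ℤ.+ f w) v ℤ.< ℤ.+ outdeg G v) → Stabilizes G σ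
  stabilize k f σ ∑f≡k stable = go (stable-or-active σ)
    where
    -- The number k of firings still available drops by one at each firing, which makes the
    -- recursion terminate.
    positive : ∀ k → ∑Fin (λ w → ℤ.+ f w) ≡ ℤ.+ k → ∀ v → Active G σ v → ∀ x → f v ≡ x → Stabilizes G σ
    positive k       ∑f≡k v active zero    fv = ⊥-elim (ℤₚ.<⇒≱ (idle⇒inactive f v fv (stable v)) active)
    positive zero    ∑f≡0 v active (suc m) fv = ⊥-elim (ℕₚ.1+n≢0 (trans (sym fv) (ℤₚ.+-injective (∑≡0⇒≡0 (λ w → ℤ.+≤+ ℕ.z≤n) ∑f≡0 v))))
    positive (suc k) ∑f≡k v active (suc m) fv =
      let τ , seq , τ-stable = stabilize k (f [ v ≔ m ]) (fire G v σ)
            (trans (shift _) (cong (-1ℤ +_) (trans (sym (∑-once-less f v fv)) ∑f≡k)))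
            (λ u → subst (ℤ._< ℤ.+ outdeg G u) (Δ-once-less f v fv σ u) (stable u))
      in τ , fireStep v active seq , τ-stable
      where
      shift : ∀ s → s ≡ -1ℤ + (1ℤ + s)
      shift = solve-∀
    go : Stable G σ ⊎ ∃ (Active G σ) → Stabilizes G σ
    go (inj₁ st)           = σ , done , st
    go (inj₂ (v , active)) = positive k ∑f≡k v active (f v) refl

  legal-Δ : ∀ {σ τ} → LegalSeq G σ τ → ∃ λ f → ∀ v → τ v ≡ σ v - Δ G f v
  legal-Δ {σ} done = (λ _ → 0ℤ) , λ v → sym (trans (cong (λ t → σ v - t) (Δ-zero G v)) (ℤₚ.+-identityʳ (σ v)))
  legal-Δ {σ} {τ} (fireStep v _ seq) with legal-Δ seq
  ... | f , eq = (λ w → 1ℤ * δ G v w + f w) , λ u → trans (eq u)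
          (trans (lem (σ u) _ _) (cong (λ t → σ u - t) (sym (Δ-fire v f u))))
    where
    lem : ∀ s a b → (s - a) - b ≡ s - (a + b)
    lem = solve-∀

  maximal : Config G
  maximal v = ℤ.+ outdeg G v - 1ℤ

  ∑-maximal : ∑Fin maximal ≡ ℤ.+ nE - ℤ.+ N
  ∑-maximal = trans (∑-minus _ _ (allFin N)) (cong₂ _-_ edges (∑-1 N))
    where
    ∑-1 : ∀ k → ∑Fin {k} (λ _ → 1ℤ) ≡ ℤ.+ k
    ∑-1 zero    = refl
    ∑-1 (suc k) = trans (∑-suc {k} (λ _ → 1ℤ)) (cong (1ℤ +_) (∑-1 k))
    edges : ∑Fin (λ v → ℤ.+ outdeg G v) ≡ ℤ.+ nE
    edges = trans (∑-cong (allFin N) (+-outdeg G)) (trans (∑-swap _ (allFin N) (allFin nE))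
      (trans (∑-cong (allFin nE) (λ a → trans (∑-cong (allFin N) (λ v → sym (ℤₚ.*-identityˡ _))) (∑-δ′ (λ _ → 1ℤ) (tail a)))) (∑-1 nE)))

  stable⇒≤maximal : ∀ {τ} → Stable G τ → ∀ v → τ v ℤ.≤ maximal v
  stable⇒≤maximal {τ} st v = subst (τ v ℤ.≤_) (ℤₚ.+-comm -1ℤ (ℤ.+ outdeg G v)) (ℤₚ.i<j⇒i≤pred[j] (st v))

  ≤maximal⇒< : ∀ {x} v → x ℤ.≤ maximal v → x ℤ.< ℤ.+ outdeg G v
  ≤maximal⇒< v le = ℤₚ.i≤pred[j]⇒i<j (subst (_ ℤ.≤_) (ℤₚ.+-comm (ℤ.+ outdeg G v) -1ℤ) le)

  -- Firing preserves the number of chips, and a stable configuration lies below `maximal` at every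
  -- vertex.
  stabilizes⇒≤ : ∀ {σ} → Stabilizes G σ → ∣_∣ G σ ℤ.≤ ℤ.+ nE - ℤ.+ N
  stabilizes⇒≤ {σ} (τ , seq , stable) with legal-Δ seq
  ... | f , eq = subst₂ ℤ._≤_ ∑τ ∑-maximal (∑-mono (allFin N) (stable⇒≤maximal stable))
    where
    open ≡-Reasoning
    ∑τ : ∑Fin τ ≡ ∑Fin σ
    ∑τ = begin
      ∑Fin τ                           ≡⟨ trans (∑-cong (allFin N) eq) (∑-minus σ (Δ G f) (allFin N)) ⟩
      ∑Fin σ - ∑Fin (Δ G f)            ≡⟨ cong (λ t → ∑Fin σ - t) (∑-Δ G f) ⟩
      ∑Fin σ - 0ℤ                      ≡⟨ ℤₚ.+-identityʳ _ ⟩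
      ∑Fin σ                           ∎

module _ {n : ℕ} (G : Graph (suc n)) where
  open Graph G

  cond3⇒cond1 : Cond3 G → Cond1 G
  cond3⇒cond1 c3 = surjective⇒cond1 G onto
    where
    open ≡-Reasoning
    onto : ∀ σ → ∣_∣ G σ ≡ 0ℤ → InImage G σ
    onto σ ∣σ∣≡0 with Equivalence.from (c3 (λ v → σ v + maximal G v)) (ℤₚ.≤-reflexive ∑σ′)
      where
      ∑σ′ : ∑Fin (λ v → σ v + maximal G v) ≡ ℤ.+ nE - ℤ.+ suc n
      ∑σ′ = trans (∑-+ σ (maximal G) (allFin (suc n))) (trans (cong₂ _+_ ∣σ∣≡0 (∑-maximal G)) (ℤₚ.+-identityˡ _))
    ... | τ , seq , stable with legal-Δ G seq
    ...   | f , eq = f , λ v → begin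
      Δ G f v                                                 ≡⟨ lem₁ (Δ G f v) (σ v) (maximal G v) ⟩
      σ v + (maximal G v - (σ v + maximal G v - Δ G f v))     ≡⟨ cong (λ t → σ v + (maximal G v - t)) (eq v) ⟨
      σ v + (maximal G v - τ v)                               ≡⟨ cong (σ v +_) (∑≡0⇒≡0 (λ u → ℤₚ.i≤j⇒0≤j-i (stable⇒≤maximal G stable u)) ∑-gap v) ⟩
      σ v + 0ℤ                                                ≡⟨ ℤₚ.+-identityʳ (σ v) ⟩
      σ v                                                     ∎
      where
      lem₁ : ∀ d s m → d ≡ s + (m - (s + m - d))
      lem₁ = solve-∀
      lem₂ : ∀ d s m → m - (s + m - d) ≡ d - s
      lem₂ = solve-∀
      -- The stable τ lies below `maximal` and has the same total, so the two coincide.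
      ∑-gap : ∑Fin (λ v → maximal G v - τ v) ≡ 0ℤ
      ∑-gap = begin
        ∑Fin (λ v → maximal G v - τ v)       ≡⟨ ∑-cong (allFin (suc n)) (λ v → trans (cong (λ t → maximal G v - t) (eq v)) (lem₂ (Δ G f v) (σ v) (maximal G v))) ⟩
        ∑Fin (λ v → Δ G f v - σ v)           ≡⟨ ∑-minus (Δ G f) σ (allFin (suc n)) ⟩
        ∑Fin (Δ G f) - ∑Fin σ                ≡⟨ cong₂ _-_ (∑-Δ G f) ∣σ∣≡0 ⟩
        0ℤ                                   ∎

  cond2⇒cond3 : StronglyConnected G → Cond2 G → Cond3 G
  cond2⇒cond3 sc M≡1 σ = mk⇔ (stabilizes⇒≤ G) from
    where
    bound = ℤ.+ nE - ℤ.+ suc n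
    from : ∣_∣ G σ ℤ.≤ bound → Stabilizes G σ
    from σ≤ = reach (Equivalence.to (cond2⇒cond1 G M≡1 (λ v → σ v - τ v)) ∑-diff)
      where
      open ≡-Reasoning
      gap = bound - ∑Fin σ
      -- The target has as many chips as σ: the excess of `maximal` over σ is removed at the vertex
      -- `zero`. It is stable because this excess is nonnegative.
      τ : Config G
      τ v = maximal G v - gap * ind ⌊ v ≟ zero ⌋
      ∑-diff : ∑Fin (λ v → σ v - τ v) ≡ 0ℤ
      ∑-diff = begin
        ∑Fin (λ v → σ v - τ v)                       ≡⟨ ∑-minus σ τ (allFin (suc n)) ⟩
        ∑Fin σ - ∑Fin τ                              ≡⟨ cong (λ t → ∑Fin σ - t) (trans (∑-minus (maximal G) (λ v → gap * ind ⌊ v ≟ zero ⌋) (allFin (suc n)))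
                                                          (cong₂ _-_ (∑-maximal G) (∑-δ {suc n} (λ _ → gap) zero))) ⟩
        ∑Fin σ - (bound - (bound - ∑Fin σ))          ≡⟨ lem (∑Fin σ) bound ⟩
        0ℤ                                           ∎
        where
        lem : ∀ s b → s - (b - (b - s)) ≡ 0ℤ
        lem = solve-∀
      τ≤ : ∀ v → τ v ℤ.≤ maximal G v
      τ≤ v = ℤₚ.0≤i-j⇒j≤i (subst (0ℤ ℤ.≤_) (lem (maximal G v) (gap * ind ⌊ v ≟ zero ⌋)) 0≤gap)
        where
        lem : ∀ m g → g ≡ m - (m - g)
        lem = solve-∀
        0≤gap : 0ℤ ℤ.≤ gap * ind ⌊ v ≟ zero ⌋
        0≤gap with ⌊ v ≟ zero ⌋
        ... | true  = subst (0ℤ ℤ.≤_) (sym (ℤₚ.*-identityʳ gap)) (ℤₚ.i≤j⇒0≤j-i σ≤)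
        ... | false = ℤₚ.≤-reflexive (sym (ℤₚ.*-zeroʳ gap))
      reach : InImage G (λ v → σ v - τ v) → Stabilizes G σ
      reach (f₀ , Δf₀) = stabilize G ℤ.∣ ∑Fin (λ v → ℤ.+ F v) ∣ F σ
          (sym (ℤₚ.0≤i⇒+∣i∣≡i (0≤∑ (λ v → ℤ.+≤+ {0} {F v} ℕ.z≤n) (allFin (suc n)))))
          (λ v → ≤maximal⇒< G v (ℤₚ.≤-trans (ℤₚ.≤-reflexive (result v)) (τ≤ v)))
        where
        -- K bounds every |f₀ v|, and κ is at least 1 everywhere, so K κ + f₀ is nonnegative; its
        -- image under Δ is that of f₀ because Δκ = 0.
        K = ∑Fin (λ v → ℤ.+ ℤ.∣ f₀ v ∣)
        f : Fin (suc n) → ℤ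
        f v = K * ℤ.+ κ G v + f₀ v
        F : Fin (suc n) → ℕ
        F v = ℤ.∣ f v ∣
        0≤f : ∀ v → 0ℤ ℤ.≤ f v
        0≤f v = 0≤K*k+x (κ G v) (κ≢0 G sc M≡1 v) (∈⇒≤∑ {f = λ u → ℤ.+ ℤ.∣ f₀ u ∣} (λ u → ℤ.+≤+ ℕ.z≤n) (∈-allFin v))
        result : ∀ v → σ v - Δ G (λ w → ℤ.+ F w) v ≡ τ v
        result v = begin
          σ v - Δ G (λ w → ℤ.+ F w) v
            ≡⟨ cong (λ t → σ v - t) (trans (Δ-cong G (λ w → ℤₚ.0≤i⇒+∣i∣≡i (0≤f w)) v) (Δ-lin G K (λ w → ℤ.+ κ G w) f₀ v)) ⟩
          σ v - (K * Δ G (λ w → ℤ.+ κ G w) v + Δ G f₀ v)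
            ≡⟨ cong₂ (λ s t → σ v - (K * s + t)) (Δ-κ G v) (Δf₀ v) ⟩
          σ v - (K * 0ℤ + (σ v - τ v))
            ≡⟨ lem (σ v) K (τ v) ⟩
          τ v ∎
          where
          lem : ∀ s k t → s - (k * 0ℤ + (s - t)) ≡ t
          lem = solve-∀

-- The sandpile group

module _ {n : ℕ} (G : Graph (suc n)) where
  open Graph G
  open ≡-Reasoning

  Δmat-β : ∀ s i → Δmat G (punchIn s i) s ≡ - β G s i
  Δmat-β s i = begin
    ℤ.+ outdeg G v * ind ⌊ v ≟ s ⌋ - ∑Fin edges     ≡⟨ cong (λ b → ℤ.+ outdeg G v * ind b - ∑Fin edges) (≟-≢ (Finₚ.punchInᵢ≢i s i)) ⟩
    ℤ.+ outdeg G v * 0ℤ - ∑Fin edges                ≡⟨ lem (ℤ.+ outdeg G v) (∑Fin edges) ⟩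
    - ∑Fin edges                                    ≡⟨ cong -_ (∑-cong (allFin nE) (λ a → ind-∧ ⌊ tail a ≟ s ⌋ ⌊ head a ≟ v ⌋)) ⟨
    - ∑Fin (λ a → ind (⌊ tail a ≟ s ⌋ ∧ ⌊ head a ≟ v ⌋)) ≡⟨ cong -_ (+-∑ (λ a → if ⌊ tail a ≟ s ⌋ ∧ ⌊ head a ≟ v ⌋ then 1 else 0) (allFin nE)) ⟨
    - β G s i                                       ∎
    where
    v = punchIn s i
    edges : Fin nE → ℤ
    edges a = ind ⌊ head a ≟ v ⌋ * ind ⌊ tail a ≟ s ⌋
    lem : ∀ d t → d * 0ℤ - t ≡ - t
    lem = solve-∀
    ind-∧ : ∀ b c → ind (b ∧ c) ≡ ind c * ind b
    ind-∧ true  true  = refl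
    ind-∧ true  false = refl
    ind-∧ false true  = refl
    ind-∧ false false = refl

  -- The dictionary between Δ and K(G,s): column s is -β, so -f s is the multiple of β, and the rest
  -- of f gives the element of the reduced lattice.
  Δ-punchIn : ∀ s f i → Δ G f (punchIn s i) ≡ - f s * β G s i + Δred G s (λ j → f (punchIn s j)) i
  Δ-punchIn s f i = begin
    Δ G f v                                                      ≡⟨ Δ-col G f v ⟩
    ∑Fin (λ w → f w * lookup (col G w) v)                        ≡⟨ ∑-cong (allFin (suc n)) (λ w → trans (cong (f w *_) (Vecₚ.lookup∘tabulate (Δ G (δ G w)) v)) (ℤₚ.*-comm (f w) (Δmat G v w))) ⟩
    ∑Fin (λ w → Δmat G v w * f w)                                ≡⟨ ∑-punchIn (λ w → Δmat G v w * f w) s ⟩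
    Δmat G v s * f s + Δred G s (λ j → f (punchIn s j)) i        ≡⟨ cong (λ t → t * f s + Δred G s (λ j → f (punchIn s j)) i) (Δmat-β s i) ⟩
    - β G s i * f s + Δred G s (λ j → f (punchIn s j)) i         ≡⟨ cong (_+ Δred G s (λ j → f (punchIn s j)) i) (lem (β G s i) (f s)) ⟩
    - f s * β G s i + Δred G s (λ j → f (punchIn s j)) i         ∎
    where
    v = punchIn s i
    lem : ∀ b f → - b * f ≡ - f * b
    lem = solve-∀

  cond1⇒cond4 : Cond1 G → Cond4 G
  cond1⇒cond4 surj s x =
    let f , Δf = Equivalence.to (surj σ) ∑σ in
    - f s , (λ j → f (punchIn s j)) , λ i → begin
      x i - - f s * β G s i                                ≡⟨ cong (_- (- f s * β G s i)) (trans (sym (insertAt-punchIn x s (- ∑Fin x) i)) (sym (Δf (punchIn s i)))) ⟩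
      Δ G f (punchIn s i) - - f s * β G s i                ≡⟨ cong (_- (- f s * β G s i)) (Δ-punchIn s f i) ⟩
      (- f s * β G s i + Δred G s (λ j → f (punchIn s j)) i) - - f s * β G s i ≡⟨ lem (- f s * β G s i) _ ⟩
      Δred G s (λ j → f (punchIn s j)) i                   ∎
    where
    lem : ∀ a b → (a + b) - a ≡ b
    lem = solve-∀
    -- The value at s is the one that makes the total 0.
    σ : Fin (suc n) → ℤ
    σ = insertAt x s (- ∑Fin x)
    ∑σ : ∑Fin σ ≡ 0ℤ
    ∑σ = begin
      ∑Fin σ                                ≡⟨ ∑-punchIn σ s ⟩
      σ s + ∑Fin (λ i → σ (punchIn s i))    ≡⟨ cong₂ _+_ (insertAt-lookup x s _) (∑-cong (allFin n) (insertAt-punchIn x s _)) ⟩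
      - ∑Fin x + ∑Fin x                     ≡⟨ ℤₚ.+-inverseˡ (∑Fin x) ⟩
      0ℤ                                    ∎

  cond5⇒cond1 : Cond5 G → Cond1 G
  cond5⇒cond1 (s , cyclic) = surjective⇒cond1 G onto
    where
    onto : ∀ σ → ∣_∣ G σ ≡ 0ℤ → InImage G σ
    onto σ ∣σ∣≡0 = f , agree
      where
      x : Fin n → ℤ
      x i = σ (punchIn s i)
      k = proj₁ (cyclic x)
      y = proj₁ (proj₂ (cyclic x))
      -- With -k at s, column s contributes k β and restores what was subtracted from x.
      f : Fin (suc n) → ℤ
      f = insertAt y s (- k)
      off-s : ∀ i → Δ G f (punchIn s i) ≡ σ (punchIn s i)
      off-s i = begin
        Δ G f (punchIn s i)                                      ≡⟨ Δ-punchIn s f i ⟩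
        - f s * β G s i + Δred G s (λ j → f (punchIn s j)) i
          ≡⟨ cong₂ (λ t r → - t * β G s i + r) (insertAt-lookup y s (- k))
               (∑-cong (allFin n) (λ j → cong (Δmat G (punchIn s i) (punchIn s j) *_) (insertAt-punchIn y s (- k) j))) ⟩
        - - k * β G s i + Δred G s y i                           ≡⟨ cong (λ t → - - k * β G s i + t) (proj₂ (proj₂ (cyclic x)) i) ⟨
        - - k * β G s i + (x i - k * β G s i)                    ≡⟨ lem k (β G s i) (x i) ⟩
        σ (punchIn s i)                                          ∎
        where
        lem : ∀ k b x → - - k * b + (x - k * b) ≡ x
        lem = solve-∀
      -- Both Δ f and σ have total 0 and agree away from s, hence also at s.
      at-s : Δ G f s ≡ σ s
      at-s = begin
        Δ G f s                                                  ≡⟨ lem (Δ G f s) (∑Fin x) ⟩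
        (Δ G f s + ∑Fin x) - ∑Fin x                              ≡⟨ cong (λ t → (Δ G f s + t) - ∑Fin x) (∑-cong (allFin n) off-s) ⟨
        (Δ G f s + ∑Fin (λ i → Δ G f (punchIn s i))) - ∑Fin x    ≡⟨ cong (_- ∑Fin x) (trans (sym (∑-punchIn (Δ G f) s)) (trans (∑-Δ G f) (sym ∣σ∣≡0))) ⟩
        ∑Fin σ - ∑Fin x                                          ≡⟨ cong (_- ∑Fin x) (∑-punchIn σ s) ⟩
        (σ s + ∑Fin x) - ∑Fin x                                  ≡⟨ lem (σ s) (∑Fin x) ⟨
        σ s                                                      ∎
        where
        lem : ∀ a b → a ≡ (a + b) - b
        lem = solve-∀
      agree : ∀ v → Δ G f v ≡ σ v
      agree v with s ≟ v
      ... | yes refl = at-s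
      ... | no s≢v   = subst (λ u → Δ G f u ≡ σ u) (Finₚ.punchIn-punchOut s≢v) (off-s (Fin.punchOut s≢v))

-- The equivalences are composed from 1 ⇔ 2, the chain 2 ⇒ 3 ⇒ 1 and the cycle 1 ⇒ 4 ⇒ 5 ⇒ 1.
theorem1p2 : ∀ {n : ℕ} (G : Graph (suc n)) → StronglyConnected G →
    (Cond1 G ⇔ Cond2 G) × (Cond2 G ⇔ Cond3 G) × (Cond3 G ⇔ Cond4 G) × (Cond4 G ⇔ Cond5 G)
theorem1p2 G sc =
    mk⇔ 1⇒2 (cond2⇒cond1 G)
  , mk⇔ (cond2⇒cond3 G sc) (1⇒2 ∘ cond3⇒cond1 G)
  , mk⇔ (cond1⇒cond4 G ∘ cond3⇒cond1 G) (cond2⇒cond3 G sc ∘ 1⇒2 ∘ 5⇒1 ∘ 4⇒5)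
  , mk⇔ 4⇒5 (cond1⇒cond4 G ∘ 5⇒1)
  where
  1⇒2 = cond1⇒cond2 G
  5⇒1 = cond5⇒cond1 G
  4⇒5 : Cond4 G → Cond5 G
  4⇒5 c4 = zero , c4 zero
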